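{- For every integer $n\geq 1$, $$F_{n}(t)=\frac{(1+t)(1+t^{2})^{n}}{2t}P_{n}^{\mathrm{udr}}\left(\frac{2t}{1+t^{2}}\right).$$ Equivalently, $$P_{n}^{\mathrm{udr}}(t)=\frac{2v}{(1+v)(1+v^{2})^{n}}F_{n}(v),\qquad\text{where } v=\frac{1-\sqrt{1-t^{2}}}{t}.$$
   Context: $\mathfrak{S}_n$ is the set of permutations $\pi=\pi_1\cdots\pi_n$ of $[n]=\{1,\dots,n\}$. An increasing run of $\pi$ is a maximal increasing consecutive subsequence. A birun of $\pi$ is a maximal monotone (increasing or decreasing) consecutive subsequence of length at least two. An up-down run of $\pi$ is either a birun of $\pi$, or the letter $\pi_1$ if it is an increasing run of length $1$; $\mathrm{udr}(\pi)$ is the number of up-down runs of $\pi$. $P_n^{\mathrm{udr}}(t)=\sum_{\pi\in\mathfrak{S}_n}t^{\mathrm{udr}(\pi)}$ for $n\ge1$. $\mathfrak{B}_n$ is the set of signed permutations: permutations $\pi$ of $\{ -n,\dots,-1,0,1,\dots,n\}$ with $\pi_{ -i}=-\pi_i$ for all $i$ (so $\pi_0=0$), written $\pi=\pi_1\cdots\pi_n$. For $\pi\in\mathfrak{B}_n$: $\mathrm{des}_B(\pi)$ is the number of $i\in\{0,1,\dots,n-1\}$ with $\pi_i>\pi_{i+1}$ (where $\pi_0=0$); the flag descent number $\mathrm{fdes}(\pi)$ is $2\,\mathrm{des}_B(\pi)$ if $\pi_1>0$ and $2\,\mathrm{des}_B(\pi)-1$ if $\pi_1<0$. $F_n(t)=\sum_{\pi\in\mathfrak{B}_n}t^{\mathrm{fdes}(\pi)}$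 for $n\ge1$. In the second identity, $\sqrt{1-t^2}$ is the formal power series in $t$ with constant term $1$, so that $v$ is a formal power series in $t$. -}

module Defs where

open import Data.Integer as ℤ using (ℤ; +_; 0ℤ)
open import Data.List using (List; []; _∷_; _++_; map; reverse; length; filter; drop; take; upTo; zip; cartesianProduct; cartesianProductWith; foldr)
open import Data.List.Relation.Unary.All using (All; all?)
open import Data.List.Relation.Unary.Linked using (Linked; linked?)
open import Data.List.Relation.Unary.Unique.Propositional using (Unique)
import Data.List.Relation.Unary.Unique.DecPropositional as DecUnique
open import Data.Nat as ℕ using (ℕ; zero; suc; _∸_; z≤n; s≤s)
import Data.Nat.Properties as ℕₚ
open import Data.Product using (Σ; _×_; _,_; proj₁; proj₂; ∃-syntax)
open import Data.Product.Properties using (≡-dec)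
open import Data.Rational as ℚ using (ℚ; 0ℚ; 1ℚ; ½)
import Data.Rational.Properties as ℚₚ
open import Data.Sum using (_⊎_)
open import Function using (_∘_)
open import Relation.Nullary using (Dec; yes; no; contradiction)
open import Relation.Nullary.Decidable using (_×-dec_; _⊎-dec_; _→-dec_)
open import Relation.Binary.PropositionalEquality

------------------------------------------------------------------------
-- Permutations

words : {A : Set} → ℕ → List A → List (List A)
words zero    as = [] ∷ []
words (suc k) as = cartesianProductWith _∷_ as (words k as)

-- One-line notations π₁ ⋯ πₙ of the permutations of {1, …, n}.
𝔖 : ℕ → List (List ℕ)
𝔖 n = filter (DecUnique.unique? ℕ._≟_) (words n (map suc (upTo n)))

-- -n, …, -1, 0, 1, …, n
[-_⋯_] : ℕ → ℕ → List ℤ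
[- m ⋯ n ] = reverse (map (λ i → ℤ.- (+ suc i)) (upTo m)) ++ map +_ (upTo (suc n))

-- π₁ ⋯ πₙ  ↦  -πₙ ⋯ -π₁ 0 π₁ ⋯ πₙ, the unique odd map on {-n, …, n}
-- with the given values on {1, …, n}.
oddExtension : List ℤ → List ℤ
oddExtension π = reverse (map ℤ.-_ π) ++ 0ℤ ∷ π

-- The words π₁ ⋯ πₙ whose odd extension is a permutation of {-n, …, n}
-- (injectivity is enough, as the set is finite).
𝔅 : ℕ → List (List ℤ)
𝔅 n = filter (DecUnique.unique? ℤ._≟_ ∘ oddExtension) (words n [- n ⋯ n ])

------------------------------------------------------------------------
-- Up-down runs

-- (a , b) stands for the consecutive subsequence π_{a+1} ⋯ π_b.
Interval : Set
Interval = ℕ × ℕ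

_⊑_ : Interval → Interval → Set
(a , b) ⊑ (c , d) = c ℕ.≤ a × b ℕ.≤ d

_⊑?_ : ∀ I J → Dec (I ⊑ J)
(a , b) ⊑? (c , d) = (c ℕ.≤? a) ×-dec (b ℕ.≤? d)

-- The (a , b) with a < b ≤ n.
intervals : ℕ → List Interval
intervals n = filter (λ I → proj₁ I ℕ.<? proj₂ I)
                     (cartesianProduct (upTo (suc n)) (upTo (suc n)))

factor : List ℕ → Interval → List ℕ
factor π (a , b) = take (b ∸ a) (drop a π)

Increasing Decreasing Monotone : List ℕ → Set
Increasing = Linked ℕ._<_
Decreasing = Linked ℕ._>_
Monotone w = Increasing w ⊎ Decreasing w

increasing? : ∀ w → Dec (Increasing w)
increasing? = linked? ℕ._<?_

monotone? : ∀ w → Dec (Monotone w)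
monotone? w = increasing? w ⊎-dec linked? ℕ._>?_ w

Maximal : (List ℕ → Set) → List ℕ → Interval → Set
Maximal P π I =
  P (factor π I) ×
  All (λ J → I ⊑ J → P (factor π J) → J ≡ I) (intervals (length π))

maximal? : {P : List ℕ → Set} → (∀ w → Dec (P w)) → ∀ π I → Dec (Maximal P π I)
maximal? P? π I =
  P? (factor π I) ×-dec
  all? (λ J → (I ⊑? J) →-dec (P? (factor π J) →-dec ≡-dec ℕ._≟_ ℕ._≟_ J I))
       (intervals (length π))

IncreasingRun : List ℕ → Interval → Set
IncreasingRun = Maximal Increasing

Birun : List ℕ → Interval → Set
Birun π I = Maximal Monotone π I × 2 ℕ.≤ length (factor π I)

UpDownRun : List ℕ → Interval → Set
UpDownRun π I = Birun π I ⊎ (I ≡ (0 , 1) × IncreasingRun π I)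

upDownRun? : ∀ π I → Dec (UpDownRun π I)
upDownRun? π I =
  (maximal? monotone? π I ×-dec (2 ℕ.≤? length (factor π I)))
  ⊎-dec
  (≡-dec ℕ._≟_ ℕ._≟_ I (0 , 1) ×-dec maximal? increasing? π I)

udr : List ℕ → ℕ
udr π = length (filter (upDownRun? π) (intervals (length π)))

------------------------------------------------------------------------
-- Flag descents

-- The zip lists the pairs (πᵢ , πᵢ₊₁) for 0 ≤ i < n, where π₀ = 0.
desB : List ℤ → ℕ
desB π = length (filter (λ p → proj₂ p ℤ.<? proj₁ p) (zip (0ℤ ∷ π) π))

-- If π₁ < 0 then desB π ≥ 1, so the subtraction does not truncate.
-- The value on the empty word is immaterial.
fdes : List ℤ → ℕ
fdes []      = 0
fdes π@(π₁ ∷ _) with π₁ ℤ.<? 0ℤ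
... | yes _ = 2 ℕ.* desB π ∸ 1
... | no  _ = 2 ℕ.* desB π

------------------------------------------------------------------------
-- The ring ℚ[[t]]

Series : Set
Series = ℕ → ℚ

tail : Series → Series
tail f = f ∘ suc

-- h 0 + ⋯ + h n
sumTo : ℕ → (ℕ → ℚ) → ℚ
sumTo zero    h = h 0
sumTo (suc n) h = h 0 ℚ.+ sumTo n (h ∘ suc)

infixl 6 _⊕_
infixl 7 _⊛_

_⊕_ : Series → Series → Series
(f ⊕ g) n = f n ℚ.+ g n

⊝_ : Series → Series
(⊝ f) n = ℚ.- f n

_⊛_ : Series → Series → Series
(f ⊛ g) n = sumTo n (λ i → f i ℚ.* g (n ∸ i))

𝟘 𝟙 𝕥 : Series
𝟘 _ = 0ℚ
𝟙 zero    = 1ℚ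
𝟙 (suc _) = 0ℚ
𝕥 zero    = 0ℚ
𝕥 (suc n) = 𝟙 n

record NonZeroSeries (f : Series) : Set where
  constructor nz
  field
    index   : ℕ
    coeff≢0 : f index ≢ 0ℚ

ℚ-*-≢0 : ∀ {p q} → p ≢ 0ℚ → q ≢ 0ℚ → p ℚ.* q ≢ 0ℚ
ℚ-*-≢0 {p} {q} p≢0 q≢0 pq≡0 = q≢0 (begin
  q                          ≡⟨ ℚₚ.*-identityˡ q ⟨
  1ℚ ℚ.* q                   ≡⟨ cong (ℚ._* q) (ℚₚ.*-inverseˡ p) ⟨
  (ℚ.1/ p) ℚ.* p ℚ.* q       ≡⟨ ℚₚ.*-assoc (ℚ.1/ p) p q ⟩
  (ℚ.1/ p) ℚ.* (p ℚ.* q)     ≡⟨ cong ((ℚ.1/ p) ℚ.*_) pq≡0 ⟩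
  (ℚ.1/ p) ℚ.* 0ℚ            ≡⟨ ℚₚ.*-zeroʳ (ℚ.1/ p) ⟩
  0ℚ                         ∎)
  where
  open ≡-Reasoning
  instance _ = ℚ.≢-nonZero p≢0

⊛-shiftˡ : ∀ f g → f 0 ≡ 0ℚ → ∀ n → (f ⊛ g) (suc n) ≡ (tail f ⊛ g) n
⊛-shiftˡ f g f₀≡0 n = begin
  f 0 ℚ.* g (suc n) ℚ.+ (tail f ⊛ g) n  ≡⟨ cong (λ x → x ℚ.* g (suc n) ℚ.+ (tail f ⊛ g) n) f₀≡0 ⟩
  0ℚ ℚ.* g (suc n) ℚ.+ (tail f ⊛ g) n   ≡⟨ cong (ℚ._+ (tail f ⊛ g) n) (ℚₚ.*-zeroˡ (g (suc n))) ⟩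
  0ℚ ℚ.+ (tail f ⊛ g) n                 ≡⟨ ℚₚ.+-identityˡ _ ⟩
  (tail f ⊛ g) n                        ∎
  where open ≡-Reasoning

-- Splitting off the last term of the Cauchy product.
⊛-last : ∀ f g n → (f ⊛ g) (suc n) ≡ (f ⊛ tail g) n ℚ.+ f (suc n) ℚ.* g 0
⊛-last f g zero    = refl
⊛-last f g (suc n) = trans
  (cong (f 0 ℚ.* g (suc (suc n)) ℚ.+_) (⊛-last (tail f) g n))
  (sym (ℚₚ.+-assoc (f 0 ℚ.* g (suc (suc n))) _ _))

⊛-shiftʳ : ∀ f g → g 0 ≡ 0ℚ → ∀ n → (f ⊛ g) (suc n) ≡ (f ⊛ tail g) n
⊛-shiftʳ f g g₀≡0 n = begin
  (f ⊛ g) (suc n)                         ≡⟨ ⊛-last f g n ⟩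
  (f ⊛ tail g) n ℚ.+ f (suc n) ℚ.* g 0    ≡⟨ cong (λ x → (f ⊛ tail g) n ℚ.+ f (suc n) ℚ.* x) g₀≡0 ⟩
  (f ⊛ tail g) n ℚ.+ f (suc n) ℚ.* 0ℚ     ≡⟨ cong ((f ⊛ tail g) n ℚ.+_) (ℚₚ.*-zeroʳ (f (suc n))) ⟩
  (f ⊛ tail g) n ℚ.+ 0ℚ                   ≡⟨ ℚₚ.+-identityʳ _ ⟩
  (f ⊛ tail g) n                          ∎
  where open ≡-Reasoning

⊛-nonZero : ∀ {f g} → NonZeroSeries f → NonZeroSeries g → NonZeroSeries (f ⊛ g)
⊛-nonZero {f} {g} (nz a fa) (nz b gb) = go f g a b fa gb
  where
  go : ∀ f g a b → f a ≢ 0ℚ → g b ≢ 0ℚ → NonZeroSeries (f ⊛ g)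
  go f g a b fa gb with f 0 ℚ.≟ 0ℚ | g 0 ℚ.≟ 0ℚ
  go f g zero    b fa gb | yes f₀ | _ = contradiction f₀ fa
  go f g (suc a) b fa gb | yes f₀ | _ with go (tail f) g a b fa gb
  ... | nz k c = nz (suc k) (c ∘ trans (sym (⊛-shiftˡ f g f₀ k)))
  go f g a zero    fa gb | no _ | yes g₀ = contradiction g₀ gb
  go f g a (suc b) fa gb | no _ | yes g₀ with go f (tail g) a b fa gb
  ... | nz k c = nz (suc k) (c ∘ trans (sym (⊛-shiftʳ f g g₀ k)))
  go f g a b fa gb | no f₀ | no g₀ = nz 0 (ℚ-*-≢0 f₀ g₀)

------------------------------------------------------------------------
-- Square roots of series with constant term 1

-- sqrtUpTo f k is the polynomial of degree at most k with constant
-- term 1 whose square agrees with f up to degree k.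
sqrtUpTo : Series → ℕ → Series
sqrtUpTo f zero    = 𝟙
sqrtUpTo f (suc k) n with n ℕ.≟ suc k
... | yes _ = ½ ℚ.* (f (suc k) ℚ.- (sqrtUpTo f k ⊛ sqrtUpTo f k) (suc k))
... | no  _ = sqrtUpTo f k n

sqrt : Series → Series
sqrt f n = sqrtUpTo f n n

sqrt-constant : ∀ f → sqrt f 0 ≡ 1ℚ
sqrt-constant f = refl

private
  sqrtUpTo-high : ∀ f k n → k ℕ.< n → sqrtUpTo f k n ≡ 0ℚ
  sqrtUpTo-high f zero    (suc n) _ = refl
  sqrtUpTo-high f (suc k) n k<n with n ℕ.≟ suc k
  ... | yes n≡k = contradiction n≡k (ℕₚ.>⇒≢ k<n)
  ... | no  _   = sqrtUpTo-high f k n (ℕₚ.<⇒≤ k<n)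

  sqrtUpTo-low : ∀ f k n → n ℕ.≤ k → sqrtUpTo f k n ≡ sqrt f n
  sqrtUpTo-low f zero    zero _ = refl
  sqrtUpTo-low f (suc k) n n≤k with n ℕ.≟ suc k
  ... | yes refl with suc k ℕ.≟ suc k
  ...   | yes _ = refl
  ...   | no ¬p = contradiction refl ¬p
  sqrtUpTo-low f (suc k) n n≤k | no n≢k =
    sqrtUpTo-low f k n (ℕₚ.≤-pred (ℕₚ.≤∧≢⇒< n≤k n≢k))

  sqrt-step : ∀ f k → sqrt f (suc k) ≡
    ½ ℚ.* (f (suc k) ℚ.- (sqrtUpTo f k ⊛ sqrtUpTo f k) (suc k))
  sqrt-step f k with suc k ℕ.≟ suc k
  ... | yes _ = refl
  ... | no ¬p = contradiction refl ¬p

  sumTo-cong : ∀ n {g h : ℕ → ℚ} → (∀ i → i ℕ.≤ n → g i ≡ h i) → sumTo n g ≡ sumTo n h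
  sumTo-cong zero    g≡h = g≡h 0 z≤n
  sumTo-cong (suc n) g≡h =
    cong₂ ℚ._+_ (g≡h 0 z≤n) (sumTo-cong n (λ i i≤n → g≡h (suc i) (s≤s i≤n)))

  ⊛-cong : ∀ n {f f′ g g′} → (∀ i → i ℕ.≤ n → f i ≡ f′ i) → (∀ i → i ℕ.≤ n → g i ≡ g′ i) →
           (f ⊛ g) n ≡ (f′ ⊛ g′) n
  ⊛-cong n f≡ g≡ = sumTo-cong n (λ i i≤n → cong₂ ℚ._*_ (f≡ i i≤n) (g≡ (n ∸ i) (ℕₚ.m∸n≤m n i)))

  double-half : ∀ x → ½ ℚ.* x ℚ.+ ½ ℚ.* x ≡ x
  double-half x = trans (sym (ℚₚ.*-distribʳ-+ x ½ ½)) (ℚₚ.*-identityˡ x)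

  -- The part of (s ⊛ s) (suc k) that involves only s 1, …, s k.
  inner : Series → ℕ → ℚ
  inner s zero    = 0ℚ
  inner s (suc k) = (tail s ⊛ tail s) k

  square-split : ∀ s → s 0 ≡ 1ℚ → ∀ k →
    (s ⊛ s) (suc k) ≡ (s (suc k) ℚ.+ s (suc k)) ℚ.+ inner s k
  square-split s s₀ zero rewrite s₀
    | ℚₚ.*-identityˡ (s 1) | ℚₚ.*-identityʳ (s 1) = sym (ℚₚ.+-identityʳ _)
  square-split s s₀ (suc k)
    rewrite ⊛-last (tail s) s k | s₀
    | ℚₚ.*-identityˡ (s (suc (suc k))) | ℚₚ.*-identityʳ (s (suc (suc k))) =
    trans (cong (s (suc (suc k)) ℚ.+_) (ℚₚ.+-comm (inner s (suc k)) (s (suc (suc k)))))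
          (sym (ℚₚ.+-assoc (s (suc (suc k))) (s (suc (suc k))) (inner s (suc k))))

  inner-cong : ∀ k {s s′} → (∀ i → i ℕ.≤ k → s i ≡ s′ i) → inner s k ≡ inner s′ k
  inner-cong zero    s≡ = refl
  inner-cong (suc k) s≡ =
    ⊛-cong k (λ i i≤k → s≡ (suc i) (s≤s i≤k)) (λ i i≤k → s≡ (suc i) (s≤s i≤k))

-- sqrt f is the square root of f with constant term 1.
sqrt-square : ∀ f → f 0 ≡ 1ℚ → ∀ n → (sqrt f ⊛ sqrt f) n ≡ f n
sqrt-square f f₀ zero    = sym f₀
sqrt-square f f₀ (suc k) = begin
  (s ⊛ s) (suc k)                                    ≡⟨ square-split s refl k ⟩
  (s (suc k) ℚ.+ s (suc k)) ℚ.+ inner s k            ≡⟨ cong (λ x → (x ℚ.+ x) ℚ.+ inner s k) (sqrt-step f k) ⟩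
  (½ ℚ.* d ℚ.+ ½ ℚ.* d) ℚ.+ inner s k                ≡⟨ cong (ℚ._+ inner s k) (double-half d) ⟩
  (f (suc k) ℚ.- (p ⊛ p) (suc k)) ℚ.+ inner s k      ≡⟨ cong (λ x → (f (suc k) ℚ.- x) ℚ.+ inner s k) p² ⟩
  (f (suc k) ℚ.- inner s k) ℚ.+ inner s k            ≡⟨ ℚₚ.+-assoc (f (suc k)) _ _ ⟩
  f (suc k) ℚ.+ (ℚ.- inner s k ℚ.+ inner s k)        ≡⟨ cong (f (suc k) ℚ.+_) (ℚₚ.+-inverseˡ (inner s k)) ⟩
  f (suc k) ℚ.+ 0ℚ                                   ≡⟨ ℚₚ.+-identityʳ _ ⟩
  f (suc k)                                          ∎
  where
  open ≡-Reasoning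
  s = sqrt f
  p = sqrtUpTo f k
  d = f (suc k) ℚ.- (p ⊛ p) (suc k)
  p² : (p ⊛ p) (suc k) ≡ inner s k
  p² = begin
    (p ⊛ p) (suc k)                          ≡⟨ square-split p (sqrtUpTo-low f k 0 z≤n) k ⟩
    (p (suc k) ℚ.+ p (suc k)) ℚ.+ inner p k  ≡⟨ cong (λ x → (x ℚ.+ x) ℚ.+ inner p k) (sqrtUpTo-high f k (suc k) ℕₚ.≤-refl) ⟩
    (0ℚ ℚ.+ 0ℚ) ℚ.+ inner p k                ≡⟨ ℚₚ.+-identityˡ (inner p k) ⟩
    inner p k                                ≡⟨ inner-cong k (sqrtUpTo-low f k) ⟩
    inner s k                                ∎

------------------------------------------------------------------------
-- The field ℚ((t)) of fractions of ℚ[[t]]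

record K : Set where
  constructor frac
  field
    num   : Series
    den   : Series
    den≢0 : NonZeroSeries den

open K

infix  4 _≈_
infixl 6 _+_ _-_
infixl 7 _*_ _/_[_]
infixr 8 _^_

_≈_ : K → K → Set
x ≈ y = ∀ n → (num x ⊛ den y) n ≡ (num y ⊛ den x) n

1-nonZero : NonZeroSeries 𝟙
1-nonZero = nz 0 (λ ())

ι : Series → K
ι f = frac f 𝟙 1-nonZero

0# 1# 2# t : K
0# = ι 𝟘
1# = ι 𝟙
2# = ι (𝟙 ⊕ 𝟙)
t  = ι 𝕥

_+_ _-_ _*_ : K → K → K
x + y = frac (num x ⊛ den y ⊕ num y ⊛ den x) (den x ⊛ den y) (⊛-nonZero (den≢0 x) (den≢0 y))
x - y = frac (num x ⊛ den y ⊕ (⊝ (num y ⊛ den x))) (den x ⊛ den y) (⊛-nonZero (den≢0 x) (den≢0 y))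
x * y = frac (num x ⊛ num y) (den x ⊛ den y) (⊛-nonZero (den≢0 x) (den≢0 y))

_^_ : K → ℕ → K
x ^ zero  = 1#
x ^ suc n = x * x ^ n

NonZero : K → Set
NonZero x = NonZeroSeries (num x)

-- x / y [ p ] is the quotient of x by y, where p shows y ≠ 0.
_/_[_] : (x y : K) → NonZero y → K
x / y [ y≢0 ] = frac (num x ⊛ den y) (den x ⊛ num y) (⊛-nonZero (den≢0 x) y≢0)

t≢0 : NonZero t
t≢0 = nz 1 (λ ())

2t≢0 : NonZero (2# * t)
2t≢0 = nz 1 (λ ())

1+t²≢0 : NonZero (1# + t ^ 2)
1+t²≢0 = nz 0 (λ ())

√1-t² : K
√1-t² = ι (sqrt (𝟙 ⊕ (⊝ (𝕥 ⊛ 𝕥))))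

v : K
v = (1# - √1-t²) / t [ t≢0 ]

^-nonZero : ∀ x n → NonZero x → NonZero (x ^ n)
^-nonZero x zero    x≢0 = 1-nonZero
^-nonZero x (suc n) x≢0 = ⊛-nonZero x≢0 (^-nonZero x n x≢0)

[1+v][1+v²]ⁿ≢0 : ∀ n → NonZero ((1# + v) * (1# + v ^ 2) ^ n)
[1+v][1+v²]ⁿ≢0 n = ⊛-nonZero {num (1# + v)} (nz 1 (λ ())) (^-nonZero (1# + v ^ 2) n (nz 2 (λ ())))

------------------------------------------------------------------------
-- The polynomials, evaluated at an element of K

sumOver : {A : Set} → List A → (A → K) → K
sumOver xs h = foldr (λ x s → h x + s) 0# xs

P^udr : ℕ → K → K
P^udr n x = sumOver (𝔖 n) (λ π → x ^ udr π)

F : ℕ → K → K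
F n x = sumOver (𝔅 n) (λ π → x ^ fdes π)

-- Write a permutation of [n + 1] as a permutation of [n] with the letter n + 1
-- inserted (with either sign, for signed permutations), and keep track of the
-- statistics.  Then the homogeneous polynomials
--
--   G_n(X , Y) = Σ X^udr(π) Y^(n - udr(π))           over 𝔖 n,
--   H_n(x , y) = Σ x^(1 + fdes(π)) y^(2n - fdes(π))  over 𝔅 n
--
-- satisfy G_{n+1} = (X + D) G_n and H_{n+1} = (x y + D) H_n, where D is the
-- derivation given by X ↦ X Y, Y ↦ X² and by x ↦ x y², y ↦ x² y, respectively.
-- The second derivation maps 2 x y to 2 x y (x² + y²), x² + y² to (2 x y)² and
-- x + y to x y (x + y), so induction gives
--
--   2 H_n(x , y) = (x + y) G_n(2 x y , x² + y²),
--
-- and both identities are the case y = 1, at x = t and at x = v, where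
-- 2 v = t (1 + v²).  The induction runs over all commutative semirings R
-- at once: applying a derivation is evaluating in the dual numbers R[ε].
module Submission where

open import Algebra.Bundles using (CommutativeRing; CommutativeSemiring)
import Algebra.Properties.CommutativeSemiring.Exp as CommExp
import Algebra.Properties.Group as GroupProperties
import Algebra.Properties.Semiring.Exp as Exp
import Algebra.Properties.Semiring.Mult as Mult
import Algebra.Solver.Ring.NaturalCoefficients.Default as Solver
open import Algebra.Structures.Biased using (isCommutativeMonoidˡ; isCommutativeSemiringˡ)
open import Data.Bool.Base using (Bool; true; false; not)
open import Data.Bool.Properties using (not-¬; ¬-not; not-involutive)
open import Data.Integer.Base as ℤ using (ℤ; 0ℤ; ∣_∣)
import Data.Integer.Properties as ℤ
open import Data.List.Base using (List; []; _∷_; [_]; _++_; cartesianProduct; concat; concatMap; drop; filter; foldr; length; map; reverse; take; upTo; zip)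
open import Data.List.Membership.Propositional using (_∈_; _∉_; find; lose)
open import Data.List.Membership.Propositional.Properties using (∈-++⁺ˡ; ∈-++⁺ʳ; ∈-++⁻; ∈-cartesianProduct⁺; ∈-cartesianProduct⁻; ∈-cartesianProductWith⁺; ∈-cartesianProductWith⁻; ∈-concatMap⁺; ∈-filter⁺; ∈-filter⁻; ∈-map⁺; ∈-map⁻; ∈-upTo⁺; ∈-upTo⁻; ∈-∃++)
open import Data.List.Membership.Propositional.Properties.WithK using (unique∧set⇒bag)
open import Data.List.Properties using (drop-[]; filter-accept; filter-all; filter-reject; length-drop; length-map; length-take; length-upTo; map-++; map-concatMap; map-∘; concatMap-map; ∷-injective)
open import Data.List.Relation.Binary.BagAndSetEquality using (∼bag⇒↭)
open import Data.List.Relation.Binary.Disjoint.Propositional using (Disjoint)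
open import Data.List.Relation.Binary.Permutation.Propositional as ↭ using (_↭_; prep; ↭-sym; ↭-trans; ↭⇒↭ₛ)
open import Data.List.Relation.Binary.Permutation.Propositional.Properties as ↭ using (All-resp-↭; shift; ↭-length; ↭-reverse; ∈-resp-↭)
import Data.List.Relation.Binary.Permutation.Setoid.Properties as ↭ₛ
open import Data.List.Relation.Unary.All as All using (All; []; _∷_)
import Data.List.Relation.Unary.All.Properties as All
open import Data.List.Relation.Unary.AllPairs using (AllPairs; []; _∷_)
import Data.List.Relation.Unary.AllPairs.Properties as AllPairs
open import Data.List.Relation.Unary.Any using (any?; here; there)
open import Data.List.Relation.Unary.Linked using (Linked; []; [-]; _∷_)
open import Data.List.Relation.Unary.Linked.Properties using (AllPairs⇒Linked)
import Data.List.Relation.Unary.Unique.DecPropositional as DecUnique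
open import Data.List.Relation.Unary.Unique.Propositional using (Unique)
open import Data.List.Relation.Unary.Unique.Propositional.Properties as Unique using (Unique[x∷xs]⇒x∉xs)
open import Data.Nat using (ℕ; _≤_)
open import Data.Nat.Base as ℕ using (zero; suc; pred; _<_; _∸_; z≤n; s≤s)
import Data.Nat.Properties as ℕ
open import Data.Product using (_×_)
open import Data.Product.Base using (_,_; proj₁; proj₂; ∃-syntax)
open import Data.Rational.Base as ℚ using (ℚ; 0ℚ)
import Data.Rational.Properties as ℚ
open import Data.Sum.Base using (_⊎_; inj₁; inj₂; [_,_]′)
open import Function.Base using (_∘_; const; id)
open import Function.Bundles using (mk⇔)
open import Level using (0ℓ; _⊔_)
open import Relation.Binary.Definitions using (tri<; tri≈; tri>)
open import Relation.Binary.PropositionalEquality as ≡ using (_≡_; _≢_)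
open import Relation.Binary.Structures using (IsEquivalence)
open import Relation.Nullary using (Dec; contradiction; does; no; yes; ¬_)
open import Relation.Nullary.Decidable using (dec-false; dec-true)

-- Direction words

-- If udr(π) = k, then of the n + 1 places for the letter n + 1, k keep udr, one raises it by 1 and
-- n - k raise it by 2. If fdes(π) = f, the numbers for both signs together are f + 1, 1 and 2n - f.
-- The exponents in G_n and H_n are chosen to be these multiplicities: a derivation brings exponents
-- down as factors, so n itself disappears from the recurrences. This is why fdes is shifted by 1,
-- and the shift becomes the t in the denominator 2t. The numbers depend only on the descents of π,
-- so the sums run over lists of descent words, with repetition. An identity valid in every
-- commutative semiring serves as a polynomial identity, so no polynomial ring has to be built. It
-- is kept free of division and subtraction, so it applies directly to fractions under
-- cross-multiplied equality.

-- A word π with π₀ = 0 is reduced to its descents: the i-th entry is true if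
-- πᵢ > πᵢ₊₁.  Inserting a letter m of larger absolute value than all others
-- replaces one entry by s ∷ not s, or appends s, where s is true if m < 0;
-- ss lists the admissible s.
insertions : List Bool → List Bool → List (List Bool)
insertions ss []       = map [_] ss
insertions ss (d ∷ ds) = map (λ s → s ∷ not s ∷ ds) ss ++ map (d ∷_) (insertions ss ds)

descentWords : List Bool → ℕ → List (List Bool)
descentWords ss zero    = [ [] ]
descentWords ss (suc n) = concatMap (insertions ss) (descentWords ss n)

-- The first argument is the direction of the preceding step. All cases are spelled out so that both
-- counts compute in the insertion lemmas, without comparing Booleans.
turns stays : Bool → List Bool → ℕ
turns _     []           = 0
turns false (false ∷ ds) = turns false ds
turns false (true ∷ ds)  = suc (turns true ds)
turns true  (false ∷ ds) = suc (turns false ds)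
turns true  (true ∷ ds)  = turns true ds
stays _     []           = 0
stays false (false ∷ ds) = suc (stays false ds)
stays false (true ∷ ds)  = stays true ds
stays true  (false ∷ ds) = stays false ds
stays true  (true ∷ ds)  = suc (stays true ds)

2descents 2ascents : List Bool → ℕ
2descents []           = 0
2descents (false ∷ ds) = 2descents ds
2descents (true ∷ ds)  = 2 ℕ.+ 2descents ds
2ascents []           = 0
2ascents (false ∷ ds) = 2 ℕ.+ 2ascents ds
2ascents (true ∷ ds)  = 2ascents ds

bit : Bool → ℕ
bit false = 0
bit true  = 1

-- The flag descent number gives weight 1 to the step from π₀ to π₁ and weight 2
-- to all others.
flagDescents flagAscents : List Bool → ℕ
flagDescents []       = 0
flagDescents (d ∷ ds) = bit d ℕ.+ 2descents ds
flagAscents []       = 0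
flagAscents (d ∷ ds) = bit (not d) ℕ.+ 2ascents ds

-- For permutations the first entry is always an ascent, from π₀ = 0 to π₁.
-- With this step included, every up-down run but the first begins with a turn.
runs nonturns : List Bool → ℕ
runs ds     = suc (turns false (drop 1 ds))
nonturns ds = stays false (drop 1 ds)

-- Finite sums in a commutative semiring.

module Sum {c ℓ} (R : CommutativeSemiring c ℓ) where
  open CommutativeSemiring R
  open import Relation.Binary.Reasoning.Setoid setoid

  ∑ : {A : Set} → List A → (A → Carrier) → Carrier
  ∑ xs h = foldr (λ x s → h x + s) 0# xs

  ∑-cong : {A : Set} {xs : List A} {g h : A → Carrier} →
           All (λ x → g x ≈ h x) xs → ∑ xs g ≈ ∑ xs h
  ∑-cong []         = refl
  ∑-cong (gx ∷ gxs) = +-cong gx (∑-cong gxs)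

  ∑-cong′ : {A : Set} (xs : List A) {g h : A → Carrier} →
            (∀ x → g x ≈ h x) → ∑ xs g ≈ ∑ xs h
  ∑-cong′ []       g≈h = refl
  ∑-cong′ (x ∷ xs) g≈h = +-cong (g≈h x) (∑-cong′ xs g≈h)

  ∑-map : {A B : Set} (f : A → B) (xs : List A) {h : B → Carrier} →
          ∑ (map f xs) h ≡ ∑ xs (h ∘ f)
  ∑-map f []       = ≡.refl
  ∑-map f (x ∷ xs) = ≡.cong (_ +_) (∑-map f xs)

  ∑-++ : {A : Set} (xs : List A) {ys : List A} {h : A → Carrier} →
         ∑ (xs ++ ys) h ≈ ∑ xs h + ∑ ys h
  ∑-++ []       = sym (+-identityˡ _)
  ∑-++ (x ∷ xs) = trans (+-congˡ (∑-++ xs)) (sym (+-assoc _ _ _))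

  ∑-concatMap : {A B : Set} (f : A → List B) (xs : List A) {h : B → Carrier} →
                ∑ (concatMap f xs) h ≈ ∑ xs (λ x → ∑ (f x) h)
  ∑-concatMap f []       = refl
  ∑-concatMap f (x ∷ xs) = trans (∑-++ (f x)) (+-congˡ (∑-concatMap f xs))

  *-∑ : {A : Set} (a : Carrier) (xs : List A) {h : A → Carrier} →
        a * ∑ xs h ≈ ∑ xs (λ x → a * h x)
  *-∑ a []       = zeroʳ a
  *-∑ a (x ∷ xs) = trans (distribˡ a _ _) (+-congˡ (*-∑ a xs))

  ∑-+ : {A : Set} (xs : List A) {g h : A → Carrier} →
        ∑ xs (λ x → g x + h x) ≈ ∑ xs g + ∑ xs h
  ∑-+ []       = sym (+-identityˡ 0#)
  ∑-+ (x ∷ xs) {g} {h} = begin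
    (g x + h x) + ∑ xs (λ x → g x + h x)   ≈⟨ +-congˡ (∑-+ xs) ⟩
    (g x + h x) + (∑ xs g + ∑ xs h)        ≈⟨ solve 4 (λ a b c d → (a :+ b) :+ (c :+ d) := (a :+ c) :+ (b :+ d)) refl _ _ _ _ ⟩
    (g x + ∑ xs g) + (h x + ∑ xs h)        ∎
    where open Solver R

  ∑-↭ : {A : Set} {xs ys : List A} {h : A → Carrier} → xs ↭ ys → ∑ xs h ≈ ∑ ys h
  ∑-↭ ↭.refl                    = refl
  ∑-↭ (↭.prep x xs↭ys)          = +-congˡ (∑-↭ xs↭ys)
  ∑-↭ {h = h} (↭.swap x y xs↭ys) = trans (x∙yz≈y∙xz (h x) (h y) _) (+-congˡ (+-congˡ (∑-↭ xs↭ys)))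
    where open import Algebra.Properties.CommutativeSemigroup +-commutativeSemigroup using (x∙yz≈y∙xz)
  ∑-↭ (↭.trans xs↭ys ys↭zs)     = trans (∑-↭ xs↭ys) (∑-↭ ys↭zs)

-- Effect of inserting a letter on turns and on flag descents.

module Recurrence {c ℓ} (R : CommutativeSemiring c ℓ) where
  open CommutativeSemiring R
  open Mult semiring using () renaming (_×_ to _·_)
  open Sum R
  open Solver R
  open import Relation.Binary.Reasoning.Setoid setoid

  -- Passing a step that is a stay shifts the second argument of h, and the last term of the counts
  -- below then contains `suc (pred e)`. This differs from `e` only where the multiplicity e is
  -- zero.
  ·-suc-pred : ∀ n (h : ℕ → Carrier) → n · h (suc (pred n)) ≡ n · h n
  ·-suc-pred zero    h = ≡.refl
  ·-suc-pred (suc n) h = ≡.refl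

  turning : (ℕ → ℕ → Carrier) → Bool → List Bool → Carrier
  turning h b ds = h (turns b ds) (stays b ds)

  -- The truncation pred 0 = 0 is immaterial, as e · h (2 + c) (pred e) vanishes for e = 0.
  ∑-turning-true : ∀ ds h → let c = turns true ds; e = stays true ds in
    ∑ (insertions [ false ] ds) (turning h true) ≈
      c · h c (suc e) + h (suc c) e + e · h (2 ℕ.+ c) (pred e)

  -- Here c and e are the counts of `true ∷ ds` after an ascent, that is, behind a peak. Inserting a
  -- larger letter just behind the peak only moves the peak and adds one stay; this is the one extra
  -- term compared with `∑-turning-true`.
  ∑-turning-peak : ∀ ds h → let c = suc (turns true ds); e = stays true ds in
    ∑ (insertions [ false ] (true ∷ ds)) (turning h false) ≈
      c · h c (suc e) + h (suc c) e + e · h (2 ℕ.+ c) (pred e)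

  -- The separate summand is the insertion into the ascent that precedes `ds`, which puts a peak
  -- there. Only together with it does the count depend on turns and stays alone: a peak can be
  -- moved by an insertion on either side of it, and one of the two places lies in the preceding
  -- ascent.
  ∑-turning-false : ∀ ds h → let c = turns false ds; e = stays false ds in
    h (suc (turns true ds)) (stays true ds) + ∑ (insertions [ false ] ds) (turning h false) ≈
      suc c · h c (suc e) + h (suc c) e + e · h (2 ℕ.+ c) (pred e)

  ∑-turning-true [] h = solve 1 (λ a → a :+ con 0 := con 0 :+ a :+ con 0) refl _
  ∑-turning-true (false ∷ ds) h = begin
    _ ≡⟨ ≡.cong (_ +_) (∑-map (false ∷_) (insertions [ false ] ds)) ⟩
    _ ≈⟨ ∑-turning-false ds (λ c e → h (suc c) e) ⟩
    _ ∎
  ∑-turning-true (true ∷ ds) h = begin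
    _ ≡⟨ ≡.cong (_ +_) (∑-map (true ∷_) (insertions [ false ] ds)) ⟩
    _ ≈⟨ +-congˡ (∑-turning-true ds (λ c e → h c (suc e))) ⟩
    _ ≈⟨ +-congˡ (+-congˡ (reflexive (·-suc-pred (stays true ds) (h (2 ℕ.+ turns true ds))))) ⟩
    _ ≈⟨ solve 4 (λ a b c d → a :+ (b :+ c :+ d) := b :+ c :+ (a :+ d)) refl _ _ _ _ ⟩
    _ ∎

  ∑-turning-peak ds h = begin
    _ ≡⟨ ≡.cong (_ +_) (∑-map (true ∷_) (insertions [ false ] ds)) ⟩
    _ ≈⟨ +-congˡ (∑-turning-true ds (λ c e → h (suc c) e)) ⟩
    _ ≈⟨ solve 4 (λ a b c d → a :+ (b :+ c :+ d) := a :+ b :+ c :+ d) refl _ _ _ _ ⟩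
    _ ∎

  ∑-turning-false [] h = solve 2 (λ a b → a :+ (b :+ con 0) := b :+ con 0 :+ a :+ con 0) refl _ _
  ∑-turning-false (false ∷ ds) h = begin
    _ ≡⟨ ≡.cong (λ x → _ + (_ + x)) (∑-map (false ∷_) (insertions [ false ] ds)) ⟩
    _ ≈⟨ +-congˡ (∑-turning-false ds (λ c e → h c (suc e))) ⟩
    _ ≈⟨ +-congˡ (+-congˡ (reflexive (·-suc-pred (stays false ds) (h (2 ℕ.+ turns false ds))))) ⟩
    _ ≈⟨ solve 4 (λ a b c d → a :+ (b :+ c :+ d) := b :+ c :+ (a :+ d)) refl _ _ _ _ ⟩
    _ ∎
  ∑-turning-false (true ∷ ds) h = begin
    _ ≈⟨ +-congˡ (∑-turning-peak ds h) ⟩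
    _ ≈⟨ solve 4 (λ a b c d → a :+ (b :+ c :+ d) := a :+ b :+ c :+ d) refl _ _ _ _ ⟩
    _ ∎

  -- Whatever s is, `s ∷ not s` has one ascent and one descent. So a descent gains an ascent and an
  -- ascent gains a descent, twice each because of the two signs, and the doubled counts are the
  -- multiplicities. Appending a letter gives the two remaining terms.
  ∑-flag : ∀ ds (h : ℕ → ℕ → Carrier) → let c = 2descents ds; e = 2ascents ds in
    ∑ (insertions (false ∷ true ∷ []) ds) (λ ds′ → h (2descents ds′) (2ascents ds′)) ≈
      suc c · h c (2 ℕ.+ e) + suc e · h (2 ℕ.+ c) e
  ∑-flag [] h = solve 2 (λ a b → a :+ (b :+ con 0) := a :+ con 0 :+ (b :+ con 0)) refl _ _
  ∑-flag (false ∷ ds) h = begin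
    _ ≡⟨ ≡.cong (λ x → _ + (_ + x)) (∑-map (false ∷_) (insertions (false ∷ true ∷ []) ds)) ⟩
    _ ≈⟨ +-congˡ (+-congˡ (∑-flag ds (λ c e → h c (2 ℕ.+ e)))) ⟩
    _ ≈⟨ solve 3 (λ a b c → a :+ (a :+ (b :+ c)) := b :+ (a :+ (a :+ c))) refl _ _ _ ⟩
    _ ∎
  ∑-flag (true ∷ ds) h = begin
    _ ≡⟨ ≡.cong (λ x → _ + (_ + x)) (∑-map (true ∷_) (insertions (false ∷ true ∷ []) ds)) ⟩
    _ ≈⟨ +-congˡ (+-congˡ (∑-flag ds (λ c e → h (2 ℕ.+ c) e))) ⟩
    _ ≈⟨ solve 3 (λ a b c → a :+ (a :+ (b :+ c)) := (a :+ (a :+ b)) :+ c) refl _ _ _ ⟩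
    _ ∎

  -- At the first step, of weight 1, the two signs differ: one raises a single count by 2, the other
  -- raises both counts by 1. The latter is the origin of the summand x y in the recurrence for H.
  ∑-flag-first : ∀ d ds (h : ℕ → ℕ → Carrier) →
    let k = flagDescents (d ∷ ds); e = flagAscents (d ∷ ds) in
    ∑ (insertions (false ∷ true ∷ []) (d ∷ ds)) (λ ds′ → h (flagDescents ds′) (flagAscents ds′)) ≈
      suc k · h k (2 ℕ.+ e) + h (suc k) (suc e) + suc e · h (2 ℕ.+ k) e
  ∑-flag-first false ds h = begin
    _ ≡⟨ ≡.cong (λ x → _ + (_ + x)) (∑-map (false ∷_) (insertions (false ∷ true ∷ []) ds)) ⟩
    _ ≈⟨ +-congˡ (+-congˡ (∑-flag ds (λ c e → h c (1 ℕ.+ e)))) ⟩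
    _ ≈⟨ solve 4 (λ a b c d → a :+ (b :+ (c :+ d)) := c :+ b :+ (a :+ d)) refl _ _ _ _ ⟩
    _ ∎
  ∑-flag-first true ds h = begin
    _ ≡⟨ ≡.cong (λ x → _ + (_ + x)) (∑-map (true ∷_) (insertions (false ∷ true ∷ []) ds)) ⟩
    _ ≈⟨ +-congˡ (+-congˡ (∑-flag ds (λ c e → h (1 ℕ.+ c) e))) ⟩
    _ ≈⟨ solve 4 (λ a b c d → a :+ (b :+ (c :+ d)) := b :+ c :+ a :+ d) refl _ _ _ _ ⟩
    _ ∎

  ∑-runs : ∀ ds (h : ℕ → ℕ → Carrier) →
    let c = turns false ds; e = stays false ds in
    ∑ (insertions [ false ] (false ∷ ds)) (λ ds′ → h (runs ds′) (nonturns ds′)) ≈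
      suc c · h (suc c) (suc e) + h (2 ℕ.+ c) e + e · h (3 ℕ.+ c) (pred e)
  ∑-runs ds h = begin
    _ ≡⟨ ≡.cong (_ +_) (∑-map (false ∷_) (insertions [ false ] ds)) ⟩
    _ ≈⟨ ∑-turning-false ds (λ c e → h (suc c) e) ⟩
    _ ∎

-- Views of the words for n ≥ 1. Neither recurrence holds at the empty word, where an insertion has
-- no entry to replace.
data StartsWithAscent : List Bool → Set where
  ascent : ∀ ds → StartsWithAscent (false ∷ ds)

data NonEmpty : List Bool → Set where
  nonEmpty : ∀ d ds → NonEmpty (d ∷ ds)

descentWords-startWithAscent : ∀ n → All StartsWithAscent (descentWords [ false ] (suc n))
descentWords-startWithAscent zero    = ascent [] ∷ []
descentWords-startWithAscent (suc n) =
  All.concat⁺ (All.map⁺ (All.map step (descentWords-startWithAscent n)))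
  where
  step : ∀ {ds} → StartsWithAscent ds → All StartsWithAscent (insertions [ false ] ds)
  step (ascent ds) = ascent _ ∷ All.map⁺ (All.universal (λ _ → ascent _) _)

descentWords-nonEmpty : ∀ ss n → All NonEmpty (descentWords ss (suc n))
descentWords-nonEmpty ss n =
  All.concat⁺ (All.map⁺ (All.universal step (descentWords ss n)))
  where
  step : ∀ ds → All NonEmpty (insertions ss ds)
  step []       = All.map⁺ (All.universal (λ _ → nonEmpty _ _) ss)
  step (d ∷ ds) = All.++⁺ (All.map⁺ (All.universal (λ _ → nonEmpty _ _) ss))
                          (All.map⁺ (All.universal (λ _ → nonEmpty _ _) _))

-- Dual numbers and the derivative of a monomial.

module DualNumbers {c ℓ} (R : CommutativeSemiring c ℓ) where
  open CommutativeSemiring R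
  open Solver R
  open import Relation.Binary.Reasoning.Setoid setoid

  R[ε] : CommutativeSemiring c ℓ
  R[ε] = record
    { Carrier = Carrier × Carrier
    ; _≈_ = λ x y → proj₁ x ≈ proj₁ y × proj₂ x ≈ proj₂ y
    ; _+_ = λ x y → proj₁ x + proj₁ y , proj₂ x + proj₂ y
    ; _*_ = λ x y → proj₁ x * proj₁ y , proj₁ x * proj₂ y + proj₂ x * proj₁ y
    ; 0# = 0# , 0#
    ; 1# = 1# , 0#
    ; isCommutativeSemiring = isCommutativeSemiringˡ record
      { +-isCommutativeMonoid = isCommutativeMonoidˡ record
        { isSemigroup = record
          { isMagma = record
            { isEquivalence = isEquivalence²
            ; ∙-cong = λ p q → +-cong (proj₁ p) (proj₁ q) , +-cong (proj₂ p) (proj₂ q)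
            }
          ; assoc = λ x y z → +-assoc _ _ _ , +-assoc _ _ _
          }
        ; identityˡ = λ x → +-identityˡ _ , +-identityˡ _
        ; comm = λ x y → +-comm _ _ , +-comm _ _
        }
      ; *-isCommutativeMonoid = isCommutativeMonoidˡ record
        { isSemigroup = record
          { isMagma = record
            { isEquivalence = isEquivalence²
            ; ∙-cong = λ p q → *-cong (proj₁ p) (proj₁ q) ,
                               +-cong (*-cong (proj₁ p) (proj₂ q)) (*-cong (proj₂ p) (proj₁ q))
            }
          ; assoc = λ x y z → *-assoc _ _ _ ,
              solve 6 (λ a a′ b b′ c c′ →
                (a :* b) :* c′ :+ (a :* b′ :+ a′ :* b) :* c :=
                a :* (b :* c′ :+ b′ :* c) :+ a′ :* (b :* c)) refl
                (proj₁ x) (proj₂ x) (proj₁ y) (proj₂ y) (proj₁ z) (proj₂ z)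
          }
        ; identityˡ = λ x → *-identityˡ _ ,
            solve 2 (λ a a′ → con 1 :* a′ :+ con 0 :* a := a′) refl (proj₁ x) (proj₂ x)
        ; comm = λ x y → *-comm _ _ ,
            solve 4 (λ a a′ b b′ → a :* b′ :+ a′ :* b := b :* a′ :+ b′ :* a) refl
              (proj₁ x) (proj₂ x) (proj₁ y) (proj₂ y)
        }
      ; distribʳ = λ x y z → distribʳ _ _ _ ,
          solve 6 (λ a a′ b b′ c c′ →
            (b :+ c) :* a′ :+ (b′ :+ c′) :* a :=
            (b :* a′ :+ b′ :* a) :+ (c :* a′ :+ c′ :* a)) refl
            (proj₁ x) (proj₂ x) (proj₁ y) (proj₂ y) (proj₁ z) (proj₂ z)
      ; zeroˡ = λ x → zeroˡ _ ,
          solve 2 (λ a a′ → con 0 :* a′ :+ con 0 :* a := con 0) refl (proj₁ x) (proj₂ x)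
      }
    }
    where
    isEquivalence² : IsEquivalence (λ x y → proj₁ x ≈ proj₁ y × proj₂ x ≈ proj₂ y)
    isEquivalence² = record
      { refl  = refl , refl
      ; sym   = λ p → sym (proj₁ p) , sym (proj₂ p)
      ; trans = λ p q → trans (proj₁ p) (proj₁ q) , trans (proj₂ p) (proj₂ q)
      }

  open Mult semiring using (×-assoc-*; ×-comm-*; ×-congʳ) renaming (_×_ to _·_)
  open Exp semiring using (_^_)
  private
    module ε = CommutativeSemiring R[ε]
    module ε^ = Exp ε.semiring
    module ∑R = Sum R
    module ∑ε = Sum R[ε]

  -- The multiple becomes a product with the element `n · 1#`, which the ring solver can treat as a
  -- variable.
  ·-natural : ∀ n x → n · x ≈ (n · 1#) * x
  ·-natural n x = trans (×-congʳ n (sym (*-identityˡ x))) (sym (×-assoc-* n 1# x))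

  -- The power rule for x ↦ a. At `n = 0` the truncated `pred n` is harmless, since the multiple is
  -- then empty.
  ^-dual : ∀ x a n → (x , a) ε^.^ n ε.≈ (x ^ n , n · (x ^ pred n * a))
  ^-dual x a zero    = refl , refl
  ^-dual x a (suc n) = *-congˡ (proj₁ ih) , (begin
    _                                             ≈⟨ +-cong (*-congˡ (proj₂ ih)) (*-congˡ (proj₁ ih)) ⟩
    x * (n · (x ^ pred n * a)) + a * x ^ n        ≈⟨ +-cong (x*-pred n) (*-comm a (x ^ n)) ⟩
    n · (x ^ n * a) + x ^ n * a                   ≈⟨ +-comm _ _ ⟩
    x ^ n * a + n · (x ^ n * a)                   ∎)
    where
    ih = ^-dual x a n
    x*-pred : ∀ n → x * (n · (x ^ pred n * a)) ≈ n · (x ^ n * a)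
    x*-pred zero    = zeroʳ x
    x*-pred (suc n) = trans (×-comm-* (suc n) x _) (×-congʳ (suc n) (sym (*-assoc x (x ^ n) a)))

  monomial-dual : ∀ x a y b k e → proj₂ (((x , a) ε^.^ k) ε.* ((y , b) ε^.^ e)) ≈
    x ^ k * ((e · 1#) * (y ^ pred e * b)) + ((k · 1#) * (x ^ pred k * a)) * y ^ e
  monomial-dual x a y b k e = +-cong
    (*-cong (proj₁ (^-dual x a k)) (trans (proj₂ (^-dual y b e)) (·-natural e _)))
    (*-cong (trans (proj₂ (^-dual x a k)) (·-natural k _)) (proj₁ (^-dual y b e)))

  ∑-proj₁ : {A : Set} (xs : List A) (h : A → ε.Carrier) → proj₁ (∑ε.∑ xs h) ≡ ∑R.∑ xs (proj₁ ∘ h)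
  ∑-proj₁ []       h = ≡.refl
  ∑-proj₁ (x ∷ xs) h = ≡.cong (_ +_) (∑-proj₁ xs h)

  ∑-proj₂ : {A : Set} (xs : List A) (h : A → ε.Carrier) → proj₂ (∑ε.∑ xs h) ≡ ∑R.∑ xs (proj₂ ∘ h)
  ∑-proj₂ []       h = ≡.refl
  ∑-proj₂ (x ∷ xs) h = ≡.cong (_ +_) (∑-proj₂ xs h)

-- The homogeneous polynomials, their recurrences and the identity between them.

module Polynomials {c ℓ} (R : CommutativeSemiring c ℓ) where
  open CommutativeSemiring R
  open Exp semiring using (_^_; ^-congˡ)
  open Sum R

  -- On a word of length n ≥ 1, `runs` and `nonturns` add up to n, and `flagDescents` and
  -- `flagAscents` to 2n - 1. Hence the exponents of y are n - udr and 2n - fdes.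
  udrMonomial flagMonomial : Carrier → Carrier → List Bool → Carrier
  udrMonomial  x y ds = x ^ runs ds * y ^ nonturns ds
  flagMonomial x y ds = x ^ suc (flagDescents ds) * y ^ suc (flagAscents ds)

  udrPoly flagPoly : ℕ → Carrier → Carrier → Carrier
  udrPoly  n x y = ∑ (descentWords [ false ] n) (udrMonomial x y)
  flagPoly n x y = ∑ (descentWords (false ∷ true ∷ []) n) (flagMonomial x y)

  UdrFlagIdentity : ℕ → Set (c ⊔ ℓ)
  UdrFlagIdentity n = ∀ x y → (1# + 1#) * flagPoly (suc n) x y ≈
                              (x + y) * udrPoly (suc n) ((1# + 1#) * (x * y)) (x * x + y * y)

  udrPoly-cong : ∀ n {x x′ y y′} → x ≈ x′ → y ≈ y′ → udrPoly n x y ≈ udrPoly n x′ y′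
  udrPoly-cong n x≈x′ y≈y′ = ∑-cong′ (descentWords [ false ] n)
    (λ ds → *-cong (^-congˡ (runs ds) x≈x′) (^-congˡ (nonturns ds) y≈y′))

-- The ε-part of a polynomial at (x + εa , y + εb) is its image at (x , y)
-- under the derivation with x ↦ a and y ↦ b.  The derivation x ↦ xy², y ↦ x²y
-- maps X = 2xy and Y = x² + y² to XY and X².
module Derivation {c ℓ} (R : CommutativeSemiring c ℓ) where
  open CommutativeSemiring R
  open Exp semiring using (_^_)
  open Mult semiring using () renaming (_×_ to _·_)
  open Sum R
  open Recurrence R
  open DualNumbers R
  open Polynomials R
  open Solver R
  open import Relation.Binary.Reasoning.Setoid setoid
  private module ε = Polynomials R[ε]

  udrPoly-proj₁ : ∀ n x a y b → proj₁ (ε.udrPoly n (x , a) (y , b)) ≈ udrPoly n x y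
  udrPoly-proj₁ n x a y b = begin
    _ ≡⟨ ∑-proj₁ (descentWords [ false ] n) _ ⟩
    _ ≈⟨ ∑-cong′ (descentWords [ false ] n) (λ ds →
           *-cong (proj₁ (^-dual x a (runs ds))) (proj₁ (^-dual y b (nonturns ds)))) ⟩
    _ ∎

  flagPoly-proj₁ : ∀ n x a y b → proj₁ (ε.flagPoly n (x , a) (y , b)) ≈ flagPoly n x y
  flagPoly-proj₁ n x a y b = begin
    _ ≡⟨ ∑-proj₁ (descentWords (false ∷ true ∷ []) n) _ ⟩
    _ ≈⟨ ∑-cong′ (descentWords (false ∷ true ∷ []) n) (λ ds →
           *-cong (proj₁ (^-dual x a (suc (flagDescents ds)))) (proj₁ (^-dual y b (suc (flagAscents ds))))) ⟩
    _ ∎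

  udrPoly-step : ∀ n x y → udrPoly (2 ℕ.+ n) x y ≈
    proj₂ (ε.udrPoly (suc n) (x , x * y) (y , x * x)) + x * udrPoly (suc n) x y
  udrPoly-step n x y = begin
    _ ≈⟨ ∑-concatMap (insertions [ false ]) words ⟩
    _ ≈⟨ ∑-cong (All.map step (descentWords-startWithAscent n)) ⟩
    _ ≈⟨ ∑-+ words ⟩
    _ ≈⟨ +-cong (reflexive (∑-proj₂ words _)) (*-∑ x words) ⟨
    _ ∎
    where
    words = descentWords [ false ] (suc n)
    step : ∀ {ds} → StartsWithAscent ds → ∑ (insertions [ false ] ds) (udrMonomial x y) ≈
           proj₂ (ε.udrMonomial (x , x * y) (y , x * x) ds) + x * udrMonomial x y ds
    step (ascent ds) = begin
      _ ≈⟨ ∑-runs ds (λ k e → x ^ k * y ^ e) ⟩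
      _ ≈⟨ +-cong (+-congʳ (·-natural (suc k) _)) (·-natural e _) ⟩
      _ ≈⟨ solve 7 (λ x y xᵏ yᵉ yᵉ⁻¹ m n →
             m :* ((x :* xᵏ) :* (y :* yᵉ)) :+ (x :* (x :* xᵏ)) :* yᵉ :+
             n :* ((x :* (x :* (x :* xᵏ))) :* yᵉ⁻¹) :=
             ((x :* xᵏ) :* (n :* (yᵉ⁻¹ :* (x :* x))) :+
             (m :* (xᵏ :* (x :* y))) :* yᵉ) :+
             x :* ((x :* xᵏ) :* yᵉ))
             refl x y (x ^ k) (y ^ e) (y ^ pred e) (suc k · 1#) (e · 1#) ⟩
      _ ≈⟨ +-congʳ (monomial-dual x (x * y) y (x * x) (suc k) e) ⟨
      _ ∎
      where
      k = turns false ds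
      e = stays false ds

  flagPoly-step : ∀ n x y → flagPoly (2 ℕ.+ n) x y ≈
    proj₂ (ε.flagPoly (suc n) (x , x * (y * y)) (y , (x * x) * y)) + x * y * flagPoly (suc n) x y
  flagPoly-step n x y = begin
    _ ≈⟨ ∑-concatMap (insertions (false ∷ true ∷ [])) words ⟩
    _ ≈⟨ ∑-cong (All.map step (descentWords-nonEmpty (false ∷ true ∷ []) n)) ⟩
    _ ≈⟨ ∑-+ words ⟩
    _ ≈⟨ +-cong (reflexive (∑-proj₂ words _)) (*-∑ (x * y) words) ⟨
    _ ∎
    where
    words = descentWords (false ∷ true ∷ []) (suc n)
    step : ∀ {ds} → NonEmpty ds → ∑ (insertions (false ∷ true ∷ []) ds) (flagMonomial x y) ≈
           proj₂ (ε.flagMonomial (x , x * (y * y)) (y , (x * x) * y) ds) + x * y * flagMonomial x y ds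
    step (nonEmpty d ds) = begin
      _ ≈⟨ ∑-flag-first d ds (λ k e → x ^ suc k * y ^ suc e) ⟩
      _ ≈⟨ +-cong (+-congʳ (·-natural (suc k) _)) (·-natural (suc e) _) ⟩
      _ ≈⟨ solve 6 (λ x y xᵏ yᵉ m n →
             m :* ((x :* xᵏ) :* (y :* (y :* (y :* yᵉ)))) :+ (x :* (x :* xᵏ)) :* (y :* (y :* yᵉ)) :+
             n :* ((x :* (x :* (x :* xᵏ))) :* (y :* yᵉ)) :=
             ((x :* xᵏ) :* (n :* (yᵉ :* ((x :* x) :* y))) :+
             (m :* (xᵏ :* (x :* (y :* y)))) :* (y :* yᵉ)) :+
             (x :* y) :* ((x :* xᵏ) :* (y :* yᵉ)))
             refl x y (x ^ k) (y ^ e) (suc k · 1#) (suc e · 1#) ⟩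
      _ ≈⟨ +-congʳ (monomial-dual x (x * (y * y)) y ((x * x) * y) (suc k) (suc e)) ⟨
      _ ∎
      where
      k = flagDescents (d ∷ ds)
      e = flagAscents (d ∷ ds)

-- The ε-part of the hypothesis over R[ε] at x̂ and ŷ is the derivative of the identity, and the
-- hypothesis over R accounts for the summand x y. The Leibniz term D(x + y) P and x y (x + y) P are
-- equal, and together they make up (x + y) X P, which the recurrence for G asks for.
2*flagPoly : ∀ {c ℓ} (R : CommutativeSemiring c ℓ) n → Polynomials.UdrFlagIdentity R n
2*flagPoly R zero x y = solve 2 (λ x y →
    (con 1 :+ con 1) :* ((x :* con 1) :* (y :* (y :* con 1)) :+
                         ((x :* (x :* con 1)) :* (y :* con 1) :+ con 0)) :=
    (x :+ y) :* ((((con 1 :+ con 1) :* (x :* y)) :* con 1) :* con 1 :+ con 0))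
    refl x y
  where
  open CommutativeSemiring R
  open Solver R
2*flagPoly R (suc n) x y = begin
    2# * flagPoly (2 ℕ.+ n) x y
      ≈⟨ *-congˡ (flagPoly-step n x y) ⟩
    2# * (proj₂ Fε + x * y * F)
      -- The vanishing summand prepares for the Leibniz term of the constant 2, whose ε-part in R[ε]
      -- is `0# + 0#`.
      ≈⟨ solve 4 (λ f f′ x y → (con 1 :+ con 1) :* (f′ :+ x :* y :* f) :=
           ((con 1 :+ con 1) :* f′ :+ con 0 :* f) :+ (x :* y) :* ((con 1 :+ con 1) :* f)) refl F (proj₂ Fε) x y ⟩
    (2# * proj₂ Fε + 0# * F) + x * y * (2# * F)
      ≈⟨ +-cong (+-congˡ (*-cong (sym (+-identityˡ 0#)) (sym (flagPoly-proj₁ (suc n) x _ y _)))) (*-congˡ (2*flagPoly R n x y)) ⟩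
    (2# * proj₂ Fε + (0# + 0#) * proj₁ Fε) + x * y * ((x + y) * P)
      ≈⟨ +-congʳ (proj₂ (2*flagPoly R[ε] n (x , x * (y * y)) (y , (x * x) * y))) ⟩
    ((x + y) * proj₂ Pε′ + (x * (y * y) + (x * x) * y) * proj₁ Pε′) + x * y * ((x + y) * P)
      ≈⟨ +-congʳ (+-cong (*-congˡ (proj₂ Pε′≈Pε)) (*-congˡ (trans (proj₁ Pε′≈Pε) (udrPoly-proj₁ (suc n) X _ Y _)))) ⟩
    ((x + y) * proj₂ Pε + (x * (y * y) + (x * x) * y) * P) + x * y * ((x + y) * P)
      ≈⟨ solve 4 (λ p p′ x y →
           ((x :+ y) :* p′ :+ (x :* (y :* y) :+ (x :* x) :* y) :* p) :+ (x :* y) :* ((x :+ y) :* p) :=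
           (x :+ y) :* (p′ :+ ((con 1 :+ con 1) :* (x :* y)) :* p)) refl P (proj₂ Pε) x y ⟩
    (x + y) * (proj₂ Pε + X * P)
      ≈⟨ *-congˡ (udrPoly-step n X Y) ⟨
    (x + y) * udrPoly (2 ℕ.+ n) X Y ∎
  where
  open CommutativeSemiring R
  open Solver R
  open import Relation.Binary.Reasoning.Setoid setoid
  open DualNumbers R
  open Derivation R
  open Polynomials R
  module ε = CommutativeSemiring R[ε]
  module εP = Polynomials R[ε]
  2# X Y F P : Carrier
  2# = 1# + 1#
  X = 2# * (x * y)
  Y = x * x + y * y
  F = flagPoly (suc n) x y
  P = udrPoly (suc n) X Y
  x̂ ŷ Fε Pε Pε′ : ε.Carrier
  x̂ = x , x * (y * y)
  ŷ = y , (x * x) * y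
  Fε = εP.flagPoly (suc n) x̂ ŷ
  Pε = εP.udrPoly (suc n) (X , X * Y) (Y , X * X)
  Pε′ = εP.udrPoly (suc n) ((ε.1# ε.+ ε.1#) ε.* (x̂ ε.* ŷ)) (x̂ ε.* x̂ ε.+ ŷ ε.* ŷ)
  Pε′≈Pε : Pε′ ε.≈ Pε
  Pε′≈Pε = εP.udrPoly-cong (suc n)
    (refl , solve 2 (λ x y →
      (con 1 :+ con 1) :* (x :* ((x :* x) :* y) :+ (x :* (y :* y)) :* y) :+ (con 0 :+ con 0) :* (x :* y) :=
      ((con 1 :+ con 1) :* (x :* y)) :* (x :* x :+ y :* y)) refl x y)
    (refl , solve 2 (λ x y →
      (x :* (x :* (y :* y)) :+ (x :* (y :* y)) :* x) :+ (y :* ((x :* x) :* y) :+ ((x :* x) :* y) :* y) :=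
      ((con 1 :+ con 1) :* (x :* y)) :* ((con 1 :+ con 1) :* (x :* y))) refl x y)

turns+stays : ∀ b ds → turns b ds ℕ.+ stays b ds ≡ length ds
turns+stays b     []           = ≡.refl
turns+stays false (false ∷ ds) = ≡.trans (ℕ.+-suc _ _) (≡.cong suc (turns+stays false ds))
turns+stays false (true ∷ ds)  = ≡.cong suc (turns+stays true ds)
turns+stays true  (false ∷ ds) = ≡.cong suc (turns+stays false ds)
turns+stays true  (true ∷ ds)  = ≡.trans (ℕ.+-suc _ _) (≡.cong suc (turns+stays true ds))

-- Algebra of quotients, of the substitution v and of fractions.

module CommutativeSemiringLemmas {c ℓ} (R : CommutativeSemiring c ℓ) where
  open CommutativeSemiring R
  open Solver R
  open import Relation.Binary.Reasoning.Setoid setoid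

  -- For c = 2, q = v and a = 1 - √(1 - t²) this is t (1 + v²) = 2 v, multiplied by t so that v
  -- enters only through v t = a.
  [t[1+q²]]t≈[cq]t : ∀ c t q a → q * t ≈ a → t * t + a * a ≈ c * a →
    (t * (1# + q * (q * 1#))) * t ≈ (c * q) * t
  [t[1+q²]]t≈[cq]t c t q a qt≈a eq = begin
    (t * (1# + q * (q * 1#))) * t  ≈⟨ solve 2 (λ t q → (t :* (con 1 :+ q :* (q :* con 1))) :* t := t :* t :+ (q :* t) :* (q :* t)) refl t q ⟩
    t * t + (q * t) * (q * t)      ≈⟨ +-congˡ (*-cong qt≈a qt≈a) ⟩
    t * t + a * a                  ≈⟨ eq ⟩
    c * a                          ≈⟨ *-congˡ qt≈a ⟨
    c * (q * t)                    ≈⟨ *-assoc c q t ⟨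
    (c * q) * t                    ∎

  quotient : ∀ q a b x y → q * b ≈ a → b * x ≈ a * y → x * b ≈ (q * y) * b
  quotient q a b x y qb≈a bx≈ay = begin
    x * b        ≈⟨ *-comm x b ⟩
    b * x        ≈⟨ bx≈ay ⟩
    a * y        ≈⟨ *-congʳ qb≈a ⟨
    (q * b) * y  ≈⟨ solve 3 (λ q b y → (q :* b) :* y := (q :* y) :* b) refl q b y ⟩
    (q * y) * b  ∎

module CommutativeRingLemmas {c ℓ} (R : CommutativeRing c ℓ) where
  open CommutativeRing R
  open Solver commutativeSemiring
  open import Relation.Binary.Reasoning.Setoid setoid

  -- Here s is √(1 - t²) and u is 1 - s. Writing this as `u + s ≈ 1#` keeps the computation within
  -- reach of the semiring solver; only s² has to be cancelled, from s² + t² = 1 = (u + s)².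
  t²+u²≈2u : ∀ t u s → u + s ≈ 1# → s * s + t * t ≈ 1# → t * t + u * u ≈ u + u
  t²+u²≈2u t u s u+s s²+t² = begin
    t * t + u * u                      ≈⟨ +-congʳ t² ⟩
    (u * u + (u * s + u * s)) + u * u  ≈⟨ solve 2 (λ u s → (u :* u :+ (u :* s :+ u :* s)) :+ u :* u := u :* (u :+ s) :+ u :* (u :+ s)) refl u s ⟩
    u * (u + s) + u * (u + s)          ≈⟨ +-cong u[u+s] u[u+s] ⟩
    u + u                              ∎
    where
    open GroupProperties +-group using (∙-cancelˡ)
    u[u+s] : u * (u + s) ≈ u
    u[u+s] = trans (*-congˡ u+s) (*-identityʳ u)
    t² : t * t ≈ u * u + (u * s + u * s)
    t² = ∙-cancelˡ (s * s) _ _ (begin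
      s * s + t * t                        ≈⟨ s²+t² ⟩
      1#                                   ≈⟨ *-identityˡ 1# ⟨
      1# * 1#                              ≈⟨ *-cong u+s u+s ⟨
      (u + s) * (u + s)                    ≈⟨ solve 2 (λ u s → (u :+ s) :* (u :+ s) := s :* s :+ (u :* u :+ (u :* s :+ u :* s))) refl u s ⟩
      s * s + (u * u + (u * s + u * s))    ∎)

-- a, b, … are numerators and a′, b′, … the corresponding denominators.
module FractionIdentities {c ℓ} (R : CommutativeSemiring c ℓ) where
  open CommutativeSemiring R
  open Solver R
  open import Relation.Binary.Reasoning.Setoid setoid

  -- Cancelling the middle denominator `b′` requires that it is not a zero divisor, so here it stays
  -- as a factor on both sides.
  frac-trans : ∀ a a′ b b′ c c′ → a * b′ ≈ b * a′ → b * c′ ≈ c * b′ →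
               (a * c′) * b′ ≈ (c * a′) * b′
  frac-trans a a′ b b′ c c′ ab bc = begin
    (a * c′) * b′  ≈⟨ solve 3 (λ x y z → (x :* y) :* z := (x :* z) :* y) refl a c′ b′ ⟩
    (a * b′) * c′  ≈⟨ *-congʳ ab ⟩
    (b * a′) * c′  ≈⟨ solve 3 (λ x y z → (x :* y) :* z := (x :* z) :* y) refl b a′ c′ ⟩
    (b * c′) * a′  ≈⟨ *-congʳ bc ⟩
    (c * b′) * a′  ≈⟨ solve 3 (λ x y z → (x :* y) :* z := (x :* z) :* y) refl c b′ a′ ⟩
    (c * a′) * b′  ∎

  frac-+-cong : ∀ a a′ b b′ c c′ d d′ → a * b′ ≈ b * a′ → c * d′ ≈ d * c′ →
                (a * c′ + c * a′) * (b′ * d′) ≈ (b * d′ + d * b′) * (a′ * c′)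
  frac-+-cong a a′ b b′ c c′ d d′ ab cd = begin
    (a * c′ + c * a′) * (b′ * d′)
      ≈⟨ solve 6 (λ a a′ c c′ b′ d′ → (a :* c′ :+ c :* a′) :* (b′ :* d′) :=
           (a :* b′) :* (c′ :* d′) :+ (c :* d′) :* (a′ :* b′)) refl a a′ c c′ b′ d′ ⟩
    (a * b′) * (c′ * d′) + (c * d′) * (a′ * b′)
      ≈⟨ +-cong (*-congʳ ab) (*-congʳ cd) ⟩
    (b * a′) * (c′ * d′) + (d * c′) * (a′ * b′)
      ≈⟨ solve 6 (λ b b′ d d′ a′ c′ → (b :* a′) :* (c′ :* d′) :+ (d :* c′) :* (a′ :* b′) :=
           (b :* d′ :+ d :* b′) :* (a′ :* c′)) refl b b′ d d′ a′ c′ ⟩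
    (b * d′ + d * b′) * (a′ * c′) ∎

  frac-*-cong : ∀ a a′ b b′ c c′ d d′ → a * b′ ≈ b * a′ → c * d′ ≈ d * c′ →
                (a * c) * (b′ * d′) ≈ (b * d) * (a′ * c′)
  frac-*-cong a a′ b b′ c c′ d d′ ab cd = begin
    (a * c) * (b′ * d′) ≈⟨ interchange a c b′ d′ ⟩
    (a * b′) * (c * d′) ≈⟨ *-cong ab cd ⟩
    (b * a′) * (d * c′) ≈⟨ interchange b a′ d c′ ⟩
    (b * d) * (a′ * c′) ∎
    where open import Algebra.Properties.CommutativeSemigroup *-commutativeSemigroup using (interchange)

  frac-+-assoc : ∀ a a′ b b′ c c′ →
    ((a * b′ + b * a′) * c′ + c * (a′ * b′)) * (a′ * (b′ * c′)) ≈
    (a * (b′ * c′) + (b * c′ + c * b′) * a′) * ((a′ * b′) * c′)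
  frac-+-assoc = solve 6 (λ a a′ b b′ c c′ →
    ((a :* b′ :+ b :* a′) :* c′ :+ c :* (a′ :* b′)) :* (a′ :* (b′ :* c′)) :=
    (a :* (b′ :* c′) :+ (b :* c′ :+ c :* b′) :* a′) :* ((a′ :* b′) :* c′)) refl

  frac-+-identityˡ : ∀ a a′ → (0# * a′ + a * 1#) * a′ ≈ a * (1# * a′)
  frac-+-identityˡ = solve 2 (λ a a′ → (con 0 :* a′ :+ a :* con 1) :* a′ := a :* (con 1 :* a′)) refl

  frac-+-comm : ∀ a a′ b b′ → (a * b′ + b * a′) * (b′ * a′) ≈ (b * a′ + a * b′) * (a′ * b′)
  frac-+-comm = solve 4 (λ a a′ b b′ →
    (a :* b′ :+ b :* a′) :* (b′ :* a′) := (b :* a′ :+ a :* b′) :* (a′ :* b′)) refl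

  frac-*-assoc : ∀ a a′ b b′ c c′ →
    ((a * b) * c) * (a′ * (b′ * c′)) ≈ (a * (b * c)) * ((a′ * b′) * c′)
  frac-*-assoc = solve 6 (λ a a′ b b′ c c′ →
    ((a :* b) :* c) :* (a′ :* (b′ :* c′)) := (a :* (b :* c)) :* ((a′ :* b′) :* c′)) refl

  frac-*-identityˡ : ∀ a a′ → (1# * a) * a′ ≈ a * (1# * a′)
  frac-*-identityˡ = solve 2 (λ a a′ → (con 1 :* a) :* a′ := a :* (con 1 :* a′)) refl

  frac-*-comm : ∀ a a′ b b′ → (a * b) * (b′ * a′) ≈ (b * a) * (a′ * b′)
  frac-*-comm = solve 4 (λ a a′ b b′ → (a :* b) :* (b′ :* a′) := (b :* a) :* (a′ :* b′)) refl

  frac-distribʳ : ∀ a a′ b b′ c c′ →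
    ((b * c′ + c * b′) * a) * ((b′ * a′) * (c′ * a′)) ≈
    ((b * a) * (c′ * a′) + (c * a) * (b′ * a′)) * ((b′ * c′) * a′)
  frac-distribʳ = solve 6 (λ a a′ b b′ c c′ →
    ((b :* c′ :+ c :* b′) :* a) :* ((b′ :* a′) :* (c′ :* a′)) :=
    ((b :* a) :* (c′ :* a′) :+ (c :* a) :* (b′ :* a′)) :* ((b′ :* c′) :* a′)) refl

  frac-zeroˡ : ∀ a a′ → (0# * a) * 1# ≈ 0# * (1# * a′)
  frac-zeroˡ = solve 2 (λ a a′ → (con 0 :* a) :* con 1 := con 0 :* (con 1 :* a′)) refl

  frac-/-* : ∀ a a′ b b′ → ((a * b′) * b) * a′ ≈ a * ((a′ * b) * b′)
  frac-/-* = solve 4 (λ a a′ b b′ → ((a :* b′) :* b) :* a′ := a :* ((a′ :* b) :* b′)) refl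

  frac-*-cancelʳ : ∀ a a′ b b′ c c′ → (a * c) * (b′ * c′) ≈ (b * c) * (a′ * c′) →
                   (a * b′) * (c * c′) ≈ (b * a′) * (c * c′)
  frac-*-cancelʳ a a′ b b′ c c′ eq = begin
    (a * b′) * (c * c′) ≈⟨ interchange a b′ c c′ ⟩
    (a * c) * (b′ * c′) ≈⟨ eq ⟩
    (b * c) * (a′ * c′) ≈⟨ interchange b c a′ c′ ⟩
    (b * a′) * (c * c′) ∎
    where open import Algebra.Properties.CommutativeSemigroup *-commutativeSemigroup using (interchange)

-- Permutations and signed permutations

module Words where
  open import Data.Integer.Base using (+_; -[1+_])
  open import Relation.Binary.PropositionalEquality using (refl; sym; trans; cong; cong₂; subst)
  open import Defs using (words; 𝔖; 𝔅; [-_⋯_]; oddExtension; fdes; Interval; _⊑_; intervals; factor; Increasing; Monotone; UpDownRun; upDownRun?; udr)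

  Unique-resp-↭ : {A : Set} {xs ys : List A} → xs ↭ ys → Unique xs → Unique ys
  Unique-resp-↭ {A} xs↭ys = ↭ₛ.Unique-resp-↭ (≡.setoid A) (↭⇒↭ₛ xs↭ys)

  unique∧set⇒↭ : {A : Set} {xs ys : List A} → Unique xs → Unique ys →
                 (∀ {x} → x ∈ xs → x ∈ ys) → (∀ {x} → x ∈ ys → x ∈ xs) → xs ↭ ys
  unique∧set⇒↭ xs! ys! xs⊆ys ys⊆xs = ∼bag⇒↭ (unique∧set⇒bag xs! ys! (mk⇔ xs⊆ys ys⊆xs))

  unique∧⊆⇒length≤ : {A : Set} {xs ys : List A} → Unique xs → (∀ {x} → x ∈ xs → x ∈ ys) →
                     length xs ≤ length ys
  unique∧⊆⇒length≤ {xs = []}     _             _     = z≤n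
  unique∧⊆⇒length≤ {xs = x ∷ xs} x∷xs!@(_ ∷ xs!) xs⊆ys with us , vs , refl ← ∈-∃++ (xs⊆ys (here refl)) =
    subst (suc (length xs) ≤_) (sym (↭-length (shift x us vs))) (s≤s (unique∧⊆⇒length≤ xs! xs⊆us++vs))
    where
    xs⊆us++vs : ∀ {y} → y ∈ xs → y ∈ us ++ vs
    xs⊆us++vs y∈xs with ∈-resp-↭ (shift x us vs) (xs⊆ys (there y∈xs))
    ... | here refl = contradiction y∈xs (Unique[x∷xs]⇒x∉xs x∷xs!)
    ... | there y∈  = y∈

  AllPairs-map-All : {A : Set} {P : A → Set} {R S : A → A → Set} →
                     (∀ {x y} → P x → P y → R x y → S x y) →
                     ∀ {xs} → All P xs → AllPairs R xs → AllPairs S xs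
  AllPairs-map-All f []         []         = []
  AllPairs-map-All f (px ∷ pxs) (rx ∷ rxs) =
    All.zipWith (λ (py , r) → f px py r) (pxs , rx) ∷ AllPairs-map-All f pxs rxs

  -- Insertion into words and enumeration by insertion.

  module _ {A : Set} where

    -- The places are visited in the same order as in `insertions`, so that descent words can be
    -- compared as lists and not only up to reordering.
    insertInto : List A → List A → List (List A)
    insertInto ms []      = map [_] ms
    insertInto ms (p ∷ w) = map (λ m → m ∷ p ∷ w) ms ++ map (p ∷_) (insertInto ms w)

    ∈-insertInto⁻ : ∀ {ms} w {z} → z ∈ insertInto ms w → ∃[ m ] m ∈ ms × z ↭ m ∷ w
    ∈-insertInto⁻ [] z∈ with m , m∈ms , refl ← ∈-map⁻ [_] z∈ = m , m∈ms , ↭.refl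
    ∈-insertInto⁻ {ms} (p ∷ w) z∈ with ∈-++⁻ (map (λ m → m ∷ p ∷ w) ms) z∈
    ... | inj₁ z∈ˡ with m , m∈ms , refl ← ∈-map⁻ (λ m → m ∷ p ∷ w) z∈ˡ = m , m∈ms , ↭.refl
    ... | inj₂ z∈ʳ with z′ , z′∈ , refl ← ∈-map⁻ (p ∷_) z∈ʳ with m , m∈ms , z′↭ ← ∈-insertInto⁻ w z′∈ =
      m , m∈ms , ↭-trans (prep p z′↭) (↭.swap p m ↭.refl)

    ∈-insertInto⁺ : ∀ {ms m} u {v} → m ∈ ms → u ++ m ∷ v ∈ insertInto ms (u ++ v)
    ∈-insertInto⁺ []      {[]}    m∈ms = ∈-map⁺ [_] m∈ms
    ∈-insertInto⁺ []      {p ∷ v} m∈ms = ∈-++⁺ˡ (∈-map⁺ (λ m → m ∷ p ∷ v) m∈ms)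
    ∈-insertInto⁺ (p ∷ u)         m∈ms = ∈-++⁺ʳ _ (∈-map⁺ (p ∷_) (∈-insertInto⁺ u m∈ms))

    -- A letter of `w` equal to the inserted one would give the same word from the places on its two
    -- sides.
    insertInto-unique : ∀ {ms} w → Unique ms → All (_∉ ms) w → Unique (insertInto ms w)
    insertInto-unique []      ms! []         = Unique.map⁺ (λ { refl → refl }) ms!
    insertInto-unique (p ∷ w) ms! (p∉ ∷ w∉) = Unique.++⁺
      (Unique.map⁺ (λ { refl → refl }) ms!)
      (Unique.map⁺ (λ { refl → refl }) (insertInto-unique w ms! w∉))
      λ (z∈ˡ , z∈ʳ) → disjoint z∈ˡ z∈ʳ
      where
      disjoint : ∀ {z} → z ∈ map (λ m → m ∷ p ∷ w) _ → z ∉ map (p ∷_) (insertInto _ w)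
      disjoint z∈ˡ z∈ʳ with ∈-map⁻ (λ m → m ∷ p ∷ w) z∈ˡ | ∈-map⁻ (p ∷_) z∈ʳ
      ... | m , m∈ms , refl | _ , _ , refl = p∉ m∈ms

  map-cong-All : {A B : Set} {f g : A → B} {xs : List A} → All (λ x → f x ≡ g x) xs → map f xs ≡ map g xs
  map-cong-All []         = refl
  map-cong-All (eq ∷ eqs) = cong₂ _∷_ eq (map-cong-All eqs)

  -- Shared by both kinds of permutations: ‖_‖ is the absolute value, and `tops n` holds the letters
  -- of absolute value n. Its entries are required to be distinct for positive values only, since 0
  -- and -0 coincide.
  module Enumeration {A : Set} (‖_‖ : A → ℕ) (tops : ℕ → List A)
    (∈-tops⁺ : ∀ {n a} → ‖ a ‖ ≡ suc n → a ∈ tops (suc n))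
    (∈-tops⁻ : ∀ {n a} → a ∈ tops n → ‖ a ‖ ≡ n)
    (tops-unique : ∀ n → Unique (tops (suc n)))
    where

    -- The common ground on which 𝔖 and 𝔅 are compared with `enumeration`. Unlike a filtered list of
    -- words, it passes easily to reorderings and through the insertion or removal of a top letter.
    Perm : ℕ → List A → Set
    Perm n w = length w ≡ n × All (λ a → 1 ≤ ‖ a ‖ × ‖ a ‖ ≤ n) w × Unique (map ‖_‖ w)

    enumeration : ℕ → List (List A)
    enumeration zero    = [ [] ]
    enumeration (suc n) = concatMap (insertInto (tops (suc n))) (enumeration n)

    Perm-resp-↭ : ∀ {n w z} → w ↭ z → Perm n w → Perm n z
    Perm-resp-↭ w↭z (len , range , distinct) =
      trans (sym (↭-length w↭z)) len , All-resp-↭ w↭z range , Unique-resp-↭ (↭.map⁺ ‖_‖ w↭z) distinct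

    Perm-extend : ∀ {n m w} → ‖ m ‖ ≡ suc n → Perm n w → Perm (suc n) (m ∷ w)
    Perm-extend m≡ (len , range , distinct) =
      cong suc len ,
      (subst (1 ≤_) (sym m≡) (s≤s z≤n) , ℕ.≤-reflexive m≡) ∷
        All.map (λ (1≤a , a≤n) → 1≤a , ℕ.m≤n⇒m≤1+n a≤n) range ,
      All.map⁺ (All.map (λ (_ , a≤n) m≡a → ℕ.<⇒≢ (s≤s a≤n) (trans (sym m≡a) m≡)) range) ∷ distinct

    Perm-restrict : ∀ {n m w} → ‖ m ‖ ≡ suc n → Perm (suc n) (m ∷ w) → Perm n w
    Perm-restrict m≡ (len , _ ∷ range , m∉ ∷ distinct) =
      ℕ.suc-injective len ,
      All.zipWith (λ ((1≤a , a≤1+n) , m≢a) →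
        1≤a , ℕ.≤-pred (ℕ.≤∧≢⇒< a≤1+n (λ a≡ → m≢a (trans m≡ (sym a≡))))) (range , All.map⁻ m∉) ,
      distinct

    -- Otherwise n + 1 distinct absolute values would lie in {1, ..., n}.
    Perm-top : ∀ {n w} → Perm (suc n) w → ∃[ m ] m ∈ w × ‖ m ‖ ≡ suc n
    Perm-top {n} {w} (len , range , distinct) with any? (λ a → ‖ a ‖ ℕ.≟ suc n) w
    ... | yes top = find top
    ... | no ¬top = contradiction
      (ℕ.≤-trans (ℕ.≤-reflexive (trans (sym len) (sym (length-map ‖_‖ w))))
        (ℕ.≤-trans (unique∧⊆⇒length≤ distinct ⊆) (ℕ.≤-reflexive (trans (length-map suc (upTo n)) (length-upTo n)))))
      ℕ.1+n≰n
      where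
      ⊆ : ∀ {k} → k ∈ map ‖_‖ w → k ∈ map suc (upTo n)
      ⊆ k∈ with a , a∈w , refl ← ∈-map⁻ ‖_‖ k∈ with ‖ a ‖ | All.lookup range a∈w | (λ a≡ → ¬top (lose a∈w a≡))
      ... | suc k | _ , s≤s k≤n | k≢ = ∈-map⁺ suc (∈-upTo⁺ (ℕ.≤∧≢⇒< k≤n (k≢ ∘ cong suc)))

    enumeration-sound : ∀ n → All (Perm n) (enumeration n)
    enumeration-sound zero    = (refl , [] , []) ∷ []
    enumeration-sound (suc n) = All.concat⁺ (All.map⁺ (All.map step (enumeration-sound n)))
      where
      step : ∀ {w} → Perm n w → All (Perm (suc n)) (insertInto (tops (suc n)) w)
      step {w} perm = All.tabulate λ z∈ → let m , m∈ , z↭ = ∈-insertInto⁻ w z∈ in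
        Perm-resp-↭ (↭-sym z↭) (Perm-extend (∈-tops⁻ m∈) perm)

    enumeration-complete : ∀ n {z} → Perm n z → z ∈ enumeration n
    enumeration-complete zero    {[]} _ = here refl
    enumeration-complete (suc n) {z} perm with m , m∈z , m≡ ← Perm-top perm with u , v , refl ← ∈-∃++ m∈z =
      ∈-concatMap⁺ (insertInto (tops (suc n))) (lose
        (enumeration-complete n (Perm-restrict m≡ (Perm-resp-↭ (shift m u v) perm)))
        (∈-insertInto⁺ u (∈-tops⁺ m≡)))

    ≤? : ∀ n a → Dec (‖ a ‖ ≤ n)
    ≤? n a = ‖ a ‖ ℕ.≤? n

    -- Undoes an insertion: every word obtained from w by inserting a top letter is sent back to w.
    -- Hence insertions into different words never coincide.
    lower : ℕ → List A → List A
    lower n = filter (≤? n)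

    lower-Perm : ∀ {n w} → Perm n w → lower n w ≡ w
    lower-Perm (_ , range , _) = filter-all (≤? _) (All.map proj₂ range)

    lower-insertInto : ∀ n w {z} → z ∈ insertInto (tops (suc n)) w → lower n z ≡ lower n w
    lower-insertInto n [] z∈ with m , m∈ , refl ← ∈-map⁻ [_] z∈ =
      filter-reject (≤? n) (ℕ.<⇒≱ (ℕ.≤-reflexive (sym (∈-tops⁻ m∈))))
    lower-insertInto n (p ∷ w) z∈ with ∈-++⁻ (map (λ m → m ∷ p ∷ w) (tops (suc n))) z∈
    ... | inj₁ z∈ˡ with m , m∈ , refl ← ∈-map⁻ (λ m → m ∷ p ∷ w) z∈ˡ =
      filter-reject (≤? n) (ℕ.<⇒≱ (ℕ.≤-reflexive (sym (∈-tops⁻ m∈))))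
    ... | inj₂ z∈ʳ with z′ , z′∈ , refl ← ∈-map⁻ (p ∷_) z∈ʳ =
      filter-∷ (lower-insertInto n w z′∈)
      where
      filter-∷ : ∀ {u v} → lower n u ≡ lower n v → lower n (p ∷ u) ≡ lower n (p ∷ v)
      filter-∷ eq with ‖ p ‖ ℕ.≤? n
      ... | yes p≤n = trans (filter-accept (≤? n) p≤n) (trans (cong (p ∷_) eq) (sym (filter-accept (≤? n) p≤n)))
      ... | no  p≰n = trans (filter-reject (≤? n) p≰n) (trans eq (sym (filter-reject (≤? n) p≰n)))

    enumeration-unique : ∀ n → Unique (enumeration n)
    enumeration-unique zero    = [] ∷ []
    enumeration-unique (suc n) = Unique.concat⁺
      (All.map⁺ (All.map (λ {w} (_ , range , _) → insertInto-unique w (tops-unique n)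
        (All.map (λ (_ , a≤n) a∈ → ℕ.<⇒≢ (s≤s a≤n) (∈-tops⁻ a∈)) range)) (enumeration-sound n)))
      (AllPairs.map⁺ (AllPairs-map-All disjoint (enumeration-sound n) (enumeration-unique n)))
      where
      disjoint : ∀ {w w′} → Perm n w → Perm n w′ → w ≢ w′ →
                 Disjoint (insertInto (tops (suc n)) w) (insertInto (tops (suc n)) w′)
      disjoint {w} {w′} perm perm′ w≢w′ (z∈ , z∈′) = w≢w′
        (trans (sym (lower-Perm perm)) (trans (sym (lower-insertInto n w z∈))
          (trans (lower-insertInto n w′ z∈′) (lower-Perm perm′))))

    -- A letter of larger absolute value compares with all others by its sign alone; this is the
    -- only property of the order that the descent words of insertions rely on.
    module Descents (descent : A → A → Bool) (negative : A → Bool)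
      (descent-top : ∀ {a m} → ‖ a ‖ < ‖ m ‖ → descent a m ≡ negative m × descent m a ≡ not (negative m))
      where

      descents : A → List A → List Bool
      descents p []      = []
      descents p (q ∷ w) = descent p q ∷ descents q w

      descents-insertInto : ∀ ms p w →
        All (λ a → All (λ m → ‖ a ‖ < ‖ m ‖) ms) (p ∷ w) →
        map (descents p) (insertInto ms w) ≡ insertions (map negative ms) (descents p w)
      descents-insertInto ms p [] (p< ∷ []) = trans (sym (map-∘ ms)) (trans
        (map-cong-All (All.map (cong [_] ∘ proj₁ ∘ descent-top) p<)) (map-∘ ms))
      descents-insertInto ms p (q ∷ w) (p< ∷ q<@(q<′ ∷ w<)) = trans
        (map-++ (descents p) (map (λ m → m ∷ q ∷ w) ms) _) (cong₂ _++_
          (trans (sym (map-∘ ms)) (trans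
            (map-cong-All (All.zipWith (λ (p<m , q<m) →
              cong₂ (λ d d′ → d ∷ d′ ∷ descents q w) (proj₁ (descent-top p<m)) (proj₂ (descent-top q<m))) (p< , q<′)))
            (map-∘ ms)))
          (trans (sym (map-∘ _)) (trans (map-∘ _)
            (cong (map (descent p q ∷_)) (descents-insertInto ms q w q<)))))

      descents-enumeration : ∀ {ss o} → ‖ o ‖ ≡ 0 → (∀ n → map negative (tops (suc n)) ≡ ss) →
        ∀ n → map (descents o) (enumeration n) ≡ descentWords ss n
      descents-enumeration o≡0 signs zero = refl
      descents-enumeration {ss} {o} o≡0 signs (suc n) = trans
        (map-concatMap (descents o) (insertInto (tops (suc n))) (enumeration n)) (trans
        (cong concat (map-cong-All (All.map step (enumeration-sound n)))) (trans
        (sym (concatMap-map (insertions ss) (descents o) (enumeration n)))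
        (cong (concatMap (insertions ss)) (descents-enumeration o≡0 signs n))))
        where
        top : ∀ {a} → ‖ a ‖ ≤ n → All (λ m → ‖ a ‖ < ‖ m ‖) (tops (suc n))
        top a≤n = All.tabulate λ m∈ → ℕ.≤-trans (s≤s a≤n) (ℕ.≤-reflexive (sym (∈-tops⁻ m∈)))
        step : ∀ {w} → Perm n w → map (descents o) (insertInto (tops (suc n)) w) ≡ insertions ss (descents o w)
        step {w} (_ , range , _) = trans
          (descents-insertInto (tops (suc n)) o w
            (top (subst (_≤ n) (sym o≡0) z≤n) ∷ All.map (top ∘ proj₂) range))
          (cong (λ ss → insertions ss (descents o w)) (signs n))

  map-unique-injective : {A B : Set} {f : A → B} {xs : List A} → Unique (map f xs) →
                         ∀ {x y} → x ∈ xs → y ∈ xs → f x ≡ f y → x ≡ y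
  map-unique-injective _ (here refl) (here refl) _ = refl
  map-unique-injective (x∉ ∷ _) (here refl) (there y∈) eq = contradiction eq (All.lookup (All.map⁻ x∉) y∈)
  map-unique-injective (y∉ ∷ _) (there x∈) (here refl) eq = contradiction (sym eq) (All.lookup (All.map⁻ y∉) x∈)
  map-unique-injective (_ ∷ u) (there x∈) (there y∈) eq = map-unique-injective u x∈ y∈ eq

  words-unique : {A : Set} {as : List A} → Unique as → ∀ k → Unique (words k as)
  words-unique as! zero    = [] ∷ []
  words-unique as! (suc k) = Unique.cartesianProductWith⁺ _∷_ ∷-injective as! (words-unique as! k)

  ∈-words⁺ : {A : Set} {as w : List A} → All (_∈ as) w → w ∈ words (length w) as
  ∈-words⁺ []         = here refl
  ∈-words⁺ (a∈ ∷ w∈) = ∈-cartesianProductWith⁺ _∷_ a∈ (∈-words⁺ w∈)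

  ∈-words⁻ : {A : Set} {as w : List A} → ∀ k → w ∈ words k as → length w ≡ k × All (_∈ as) w
  ∈-words⁻ zero (here refl) = refl , []
  ∈-words⁻ {as = as} (suc k) w∈ with _ , _ , a∈ , v∈ , refl ← ∈-cartesianProductWith⁻ _∷_ as (words k as) w∈ =
    let len , all = ∈-words⁻ k v∈ in cong suc len , a∈ ∷ all

  -- 𝔖 and 𝔅 as instances of the enumeration.

  module Unsigned where
    private
      ∣_∣ᴺ : ℕ → ℕ
      ∣ n ∣ᴺ = n

      tops : ℕ → List ℕ
      tops n = [ n ]

      ∈-tops⁺ : ∀ {n a} → ∣ a ∣ᴺ ≡ suc n → a ∈ tops (suc n)
      ∈-tops⁺ refl = here refl

      ∈-tops⁻ : ∀ {n a} → a ∈ tops n → ∣ a ∣ᴺ ≡ n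
      ∈-tops⁻ (here refl) = refl

      tops-unique : ∀ n → Unique (tops (suc n))
      tops-unique n = [] ∷ []

    open Enumeration ∣_∣ᴺ tops ∈-tops⁺ ∈-tops⁻ tops-unique public

    descent : ℕ → ℕ → Bool
    descent a b = does (b ℕ.<? a)

    private
      negative : ℕ → Bool
      negative _ = false

      descent-top : ∀ {a m} → ∣ a ∣ᴺ < ∣ m ∣ᴺ → descent a m ≡ negative m × descent m a ≡ not (negative m)
      descent-top a<m = dec-false (_ ℕ.<? _) (ℕ.<⇒≯ a<m) , dec-true (_ ℕ.<? _) a<m

    open Descents descent negative descent-top public

    𝔖⇒Perm : ∀ {n w} → w ∈ 𝔖 n → Perm n w
    𝔖⇒Perm {n} {w} w∈ with w∈words , w! ← ∈-filter⁻ (DecUnique.unique? ℕ._≟_) {xs = words n (map suc (upTo n))} w∈ with len , all ← ∈-words⁻ n w∈words =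
      len , All.map range all , Unique.map⁺ id w!
      where
      range : ∀ {a} → a ∈ map suc (upTo n) → 1 ≤ a × a ≤ n
      range a∈ with _ , i∈ , refl ← ∈-map⁻ suc a∈ = s≤s z≤n , ∈-upTo⁻ i∈

    Perm⇒𝔖 : ∀ {n w} → Perm n w → w ∈ 𝔖 n
    Perm⇒𝔖 {w = w} (refl , all , w!) =
      ∈-filter⁺ (DecUnique.unique? ℕ._≟_) (∈-words⁺ (All.map range all)) (Unique.map⁻ w!)
      where
      range : ∀ {a} → 1 ≤ a × a ≤ length w → a ∈ map suc (upTo (length w))
      range {suc a} (_ , a<n) = ∈-map⁺ suc (∈-upTo⁺ a<n)

    𝔖↭enumeration : ∀ n → 𝔖 n ↭ enumeration n
    𝔖↭enumeration n = unique∧set⇒↭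
      (Unique.filter⁺ (DecUnique.unique? ℕ._≟_) (words-unique (Unique.map⁺ ℕ.suc-injective (Unique.upTo⁺ n)) n))
      (enumeration-unique n)
      (enumeration-complete n ∘ 𝔖⇒Perm)
      (Perm⇒𝔖 ∘ All.lookup (enumeration-sound n))

  module Signed where
    private
      ±_ : ℕ → List ℤ
      ± n = + n ∷ ℤ.- (+ n) ∷ []

      ∈-±⁺ : ∀ {n a} → ∣ a ∣ ≡ suc n → a ∈ ± suc n
      ∈-±⁺ {a = + _}      refl = here refl
      ∈-±⁺ {a = -[1+ _ ]} refl = there (here refl)

      ∈-±⁻ : ∀ {n a} → a ∈ ± n → ∣ a ∣ ≡ n
      ∈-±⁻ (here refl)             = refl
      ∈-±⁻ {n} (there (here refl)) = ℤ.∣-i∣≡∣i∣ (+ n)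

      descent : ℤ → ℤ → Bool
      descent a b = does (b ℤ.<? a)

      negative : ℤ → Bool
      negative (+ _)      = false
      negative (-[1+ _ ]) = true

      ∣i∣<n⇒i<+n : ∀ {i n} → ∣ i ∣ < n → i ℤ.< + n
      ∣i∣<n⇒i<+n {+ _}      i<n = ℤ.+<+ i<n
      ∣i∣<n⇒i<+n { -[1+ _ ]} _   = ℤ.-<+

      ∣i∣≤n⇒-[1+n]<i : ∀ {i n} → ∣ i ∣ ≤ n → -[1+ n ] ℤ.< i
      ∣i∣≤n⇒-[1+n]<i {+ _}      _   = ℤ.-<+
      ∣i∣≤n⇒-[1+n]<i { -[1+ _ ]} i≤n = ℤ.-<- i≤n

      descent-top : ∀ {a m} → ∣ a ∣ < ∣ m ∣ → descent a m ≡ negative m × descent m a ≡ not (negative m)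
      descent-top {a} {+ _} a<m =
        dec-false (_ ℤ.<? _) (ℤ.≤⇒≯ (ℤ.<⇒≤ (∣i∣<n⇒i<+n {a} a<m))) , dec-true (_ ℤ.<? _) (∣i∣<n⇒i<+n {a} a<m)
      descent-top {a} { -[1+ _ ]} (s≤s a≤k) =
        dec-true (_ ℤ.<? _) (∣i∣≤n⇒-[1+n]<i {a} a≤k) , dec-false (_ ℤ.<? _) (ℤ.≤⇒≯ (ℤ.<⇒≤ (∣i∣≤n⇒-[1+n]<i {a} a≤k)))

      ±-unique : ∀ n → Unique (± suc n)
      ±-unique n = ((λ ()) ∷ []) ∷ [] ∷ []

    open Enumeration ∣_∣ ±_ ∈-±⁺ ∈-±⁻ ±-unique public
    open Descents descent negative descent-top public

    private
      neg : ℕ → ℤ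
      neg i = ℤ.- (+ suc i)

    [-n⋯n]-unique : ∀ n → Unique [- n ⋯ n ]
    [-n⋯n]-unique n = Unique.++⁺
      (Unique-resp-↭ (↭-sym (↭-reverse (map neg (upTo n))))
        (Unique.map⁺ (λ eq → ℕ.suc-injective (ℤ.+-injective (ℤ.neg-injective eq))) (Unique.upTo⁺ n)))
      (Unique.map⁺ ℤ.+-injective (Unique.upTo⁺ (suc n)))
      (λ (x∈ˡ , x∈ʳ) → disjoint (∈-map⁻ neg {xs = upTo n} (∈-resp-↭ (↭-reverse (map neg (upTo n))) x∈ˡ)) (∈-map⁻ +_ x∈ʳ))
      where
      disjoint : ∀ {x} → ∃[ i ] i ∈ upTo n × x ≡ ℤ.- (+ suc i) → ¬ (∃[ i ] i ∈ upTo (suc n) × x ≡ + i)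
      disjoint (_ , _ , refl) (_ , _ , ())

    ∈-[-n⋯n]⁻ : ∀ n {a} → a ∈ [- n ⋯ n ] → ∣ a ∣ ≤ n
    ∈-[-n⋯n]⁻ n a∈ with ∈-++⁻ (reverse (map neg (upTo n))) a∈
    ... | inj₁ a∈ˡ with _ , i∈ , refl ← ∈-map⁻ neg (∈-resp-↭ (↭-reverse (map neg (upTo n))) a∈ˡ) = ∈-upTo⁻ i∈
    ... | inj₂ a∈ʳ with _ , i∈ , refl ← ∈-map⁻ +_ a∈ʳ = ℕ.≤-pred (∈-upTo⁻ i∈)

    ∈-[-n⋯n]⁺ : ∀ {n a} → ∣ a ∣ ≤ n → a ∈ [- n ⋯ n ]
    ∈-[-n⋯n]⁺ {a = + _}      a≤n = ∈-++⁺ʳ _ (∈-map⁺ +_ (∈-upTo⁺ (s≤s a≤n)))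
    ∈-[-n⋯n]⁺ {a = -[1+ _ ]} a≤n =
      ∈-++⁺ˡ (∈-resp-↭ (↭-sym (↭-reverse _)) (∈-map⁺ neg (∈-upTo⁺ a≤n)))

    oddExtension-↭ : ∀ w → oddExtension w ↭ 0ℤ ∷ w ++ map ℤ.-_ w
    oddExtension-↭ w = ↭-trans (↭.++⁺ʳ (0ℤ ∷ w) (↭-reverse (map ℤ.-_ w))) (↭.++-comm (map ℤ.-_ w) (0ℤ ∷ w))

    ∣∣-≢ : ∀ {a b} → a ≢ b → a ≢ ℤ.- b → ∣ a ∣ ≢ ∣ b ∣
    ∣∣-≢ {+ _}      {+ _}      a≢b a≢-b refl = a≢b refl
    ∣∣-≢ {+ _}      { -[1+ _ ]} a≢b a≢-b refl = a≢-b refl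
    ∣∣-≢ { -[1+ _ ]} {+ _}      a≢b a≢-b refl = a≢-b refl
    ∣∣-≢ { -[1+ _ ]} { -[1+ _ ]} a≢b a≢-b refl = a≢b refl

    oddExtension-unique⁻ : ∀ w → Unique (oddExtension w) → All (λ a → 1 ≤ ∣ a ∣) w × Unique (map ∣_∣ w)
    oddExtension-unique⁻ w odd! with 0∉ ∷ w±! ← Unique-resp-↭ (oddExtension-↭ w) odd! =
      All.map (λ {a} 0≢a → ℕ.n≢0⇒n>0 (0≢a ∘ sym ∘ ℤ.∣i∣≡0⇒i≡0)) (All.++⁻ˡ w 0∉) , split w w±!
      where
      split : ∀ w → Unique (w ++ map ℤ.-_ w) → Unique (map ∣_∣ w)
      split []      []           = []
      -- Moving -a to the front of the rest and dropping it leaves `w` followed by its negatives,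
      -- the shape needed for the recursion. That a differs from b and from -b gives distinct
      -- absolute values.
      split (a ∷ w) (a∉ ∷ w±!) with -a∉ ∷ w±!′ ← Unique-resp-↭ (shift (ℤ.- a) w (map ℤ.-_ w)) w±! =
        All.map⁺ (All.zipWith (λ (a≢b , a≢-b) → ∣∣-≢ a≢b a≢-b)
          (All.++⁻ˡ w a∉ , All.map⁻ (All.drop⁺ 1 (All.++⁻ʳ w a∉)))) ∷ split w w±!′

    oddExtension-unique⁺ : ∀ {w} → All (λ a → 1 ≤ ∣ a ∣) w → Unique (map ∣_∣ w) → Unique (oddExtension w)
    oddExtension-unique⁺ {w} nonzero w! = Unique-resp-↭ (↭-sym (oddExtension-↭ w))
      (All.++⁺ (All.map (λ { {+ suc _} _ () ; { -[1+ _ ]} _ () }) nonzero)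
               (All.map⁺ (All.map (λ { {+ suc _} _ () ; { -[1+ _ ]} _ () }) nonzero)) ∷
       Unique.++⁺ (Unique.map⁻ w!) (Unique.map⁺ ℤ.neg-injective (Unique.map⁻ w!)) disjoint)
      where
      disjoint : ∀ {a} → ¬ (a ∈ w × a ∈ map ℤ.-_ w)
      disjoint (a∈w , a∈-w) with b , b∈w , refl ← ∈-map⁻ ℤ.-_ a∈-w =
        nonfixed (All.lookup nonzero b∈w) (map-unique-injective w! a∈w b∈w (ℤ.∣-i∣≡∣i∣ b))
        where
        nonfixed : ∀ {b} → 1 ≤ ∣ b ∣ → ℤ.- b ≢ b
        nonfixed {+ suc _}   _ ()
        nonfixed { -[1+ _ ]} _ ()

    𝔅⇒Perm : ∀ {n w} → w ∈ 𝔅 n → Perm n w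
    𝔅⇒Perm {n} {w} w∈
      with w∈words , odd! ← ∈-filter⁻ (DecUnique.unique? ℤ._≟_ ∘ oddExtension) {xs = words n [- n ⋯ n ]} w∈
      with len , all ← ∈-words⁻ n w∈words
      with nonzero , w! ← oddExtension-unique⁻ w odd! =
      len , All.zip (nonzero , All.map (∈-[-n⋯n]⁻ n) all) , w!

    Perm⇒𝔅 : ∀ {n w} → Perm n w → w ∈ 𝔅 n
    Perm⇒𝔅 (refl , all , w!) = ∈-filter⁺ (DecUnique.unique? ℤ._≟_ ∘ oddExtension)
      (∈-words⁺ (All.map (∈-[-n⋯n]⁺ ∘ proj₂) all)) (oddExtension-unique⁺ (All.map proj₁ all) w!)

    𝔅↭enumeration : ∀ n → 𝔅 n ↭ enumeration n
    𝔅↭enumeration n = unique∧set⇒↭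
      (Unique.filter⁺ (DecUnique.unique? ℤ._≟_ ∘ oddExtension) (words-unique ([-n⋯n]-unique n) n))
      (enumeration-unique n)
      (enumeration-complete n ∘ 𝔅⇒Perm)
      (Perm⇒𝔅 ∘ All.lookup (enumeration-sound n))

    2*des≡2descents : ∀ a w →
      2 ℕ.* length (filter (λ p → proj₂ p ℤ.<? proj₁ p) (zip (a ∷ w) w)) ≡ 2descents (descents a w)
    2*des≡2descents a []      = refl
    2*des≡2descents a (b ∷ w) with does (b ℤ.<? a)
    ... | true  = trans (ℕ.*-suc 2 _) (cong (2 ℕ.+_) (2*des≡2descents b w))
    ... | false = 2*des≡2descents b w

    -- The first step is a descent exactly if π₁ < 0, so the subtracted 1 lowers the weight of this
    -- descent from 2 to 1.
    fdes≡flagDescents : ∀ w → fdes w ≡ flagDescents (descents 0ℤ w)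
    fdes≡flagDescents []      = refl
    fdes≡flagDescents (b ∷ w) with b ℤ.<? 0ℤ
    ... | yes b<0 = trans (cong (ℕ._∸ 1) (2*des≡2descents 0ℤ (b ∷ w)))
      (cong (λ d → 2descents (d ∷ descents b w) ℕ.∸ 1) (dec-true (b ℤ.<? 0ℤ) b<0))
    ... | no  b≮0 = trans (2*des≡2descents 0ℤ (b ∷ w))
      (cong (λ d → 2descents (d ∷ descents b w)) (dec-false (b ℤ.<? 0ℤ) b≮0))

-- Up-down runs

  open Unsigned using (descent; descents)

  ∈-intervals⁺ : ∀ {n a b} → a < b → b ≤ n → (a , b) ∈ intervals n
  ∈-intervals⁺ a<b b≤n = ∈-filter⁺ (λ I → proj₁ I ℕ.<? proj₂ I)
    (∈-cartesianProduct⁺ (∈-upTo⁺ (ℕ.m≤n⇒m≤1+n (ℕ.≤-trans a<b b≤n))) (∈-upTo⁺ (s≤s b≤n))) a<b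

  ∈-intervals⁻ : ∀ n {a b} → (a , b) ∈ intervals n → a < b × b ≤ n
  ∈-intervals⁻ n I∈
    with I∈′ , a<b ← ∈-filter⁻ (λ I → proj₁ I ℕ.<? proj₂ I) {xs = cartesianProduct (upTo (suc n)) (upTo (suc n))} I∈
    with _ , b∈ ← ∈-cartesianProduct⁻ (upTo (suc n)) (upTo (suc n)) I∈′ =
    a<b , ℕ.≤-pred (∈-upTo⁻ b∈)

  intervals-unique : ∀ n → Unique (intervals n)
  intervals-unique n = Unique.filter⁺ (λ I → proj₁ I ℕ.<? proj₂ I)
    (Unique.cartesianProduct⁺ (Unique.upTo⁺ (suc n)) (Unique.upTo⁺ (suc n)))

  -- The value false beyond the end of the word is immaterial.
  at : List Bool → ℕ → Bool
  at []       _       = false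
  at (d ∷ ds) zero    = d
  at (d ∷ ds) (suc i) = at ds i

  -- The up-down runs ending at letter c or later, where letters are numbered from
  -- 0, the run through c has direction d and starts at s, and ds are the steps
  -- after c.
  runsFrom : Bool → ℕ → ℕ → List Bool → List Interval
  runsFrom d     s c []           = [ s , suc c ]
  runsFrom false s c (false ∷ ds) = runsFrom false s (suc c) ds
  runsFrom false s c (true ∷ ds)  = (s , suc c) ∷ runsFrom true c (suc c) ds
  runsFrom true  s c (false ∷ ds) = (s , suc c) ∷ runsFrom false c (suc c) ds
  runsFrom true  s c (true ∷ ds)  = runsFrom true s (suc c) ds

  length-runsFrom : ∀ d s c ds → length (runsFrom d s c ds) ≡ suc (turns d ds)
  length-runsFrom d     s c []           = refl
  length-runsFrom false s c (false ∷ ds) = length-runsFrom false s (suc c) ds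
  length-runsFrom false s c (true ∷ ds)  = cong suc (length-runsFrom true c (suc c) ds)
  length-runsFrom true  s c (false ∷ ds) = cong suc (length-runsFrom false c (suc c) ds)
  length-runsFrom true  s c (true ∷ ds)  = length-runsFrom true s (suc c) ds

  runsFrom-ends : ∀ d s c ds → All (λ I → c < proj₂ I) (runsFrom d s c ds)
  runsFrom-ends d     s c []           = ℕ.≤-refl ∷ []
  runsFrom-ends false s c (false ∷ ds) = All.map ℕ.<⇒≤ (runsFrom-ends false s (suc c) ds)
  runsFrom-ends false s c (true ∷ ds)  = ℕ.≤-refl ∷ All.map ℕ.<⇒≤ (runsFrom-ends true c (suc c) ds)
  runsFrom-ends true  s c (false ∷ ds) = ℕ.≤-refl ∷ All.map ℕ.<⇒≤ (runsFrom-ends false c (suc c) ds)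
  runsFrom-ends true  s c (true ∷ ds)  = All.map ℕ.<⇒≤ (runsFrom-ends true s (suc c) ds)

  runsFrom-unique : ∀ d s c ds → Unique (runsFrom d s c ds)
  runsFrom-unique d     s c []           = [] ∷ []
  runsFrom-unique false s c (false ∷ ds) = runsFrom-unique false s (suc c) ds
  runsFrom-unique false s c (true ∷ ds)  =
    All.map (λ { c< refl → ℕ.<-irrefl refl c< }) (runsFrom-ends true c (suc c) ds) ∷ runsFrom-unique true c (suc c) ds
  runsFrom-unique true  s c (false ∷ ds) =
    All.map (λ { c< refl → ℕ.<-irrefl refl c< }) (runsFrom-ends false c (suc c) ds) ∷ runsFrom-unique false c (suc c) ds
  runsFrom-unique true  s c (true ∷ ds)  = runsFrom-unique true s (suc c) ds

  -- δ i is the direction of the step from letter i to letter i + 1, and n is the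
  -- number of letters.
  module Runs (δ : ℕ → Bool) (n : ℕ) where

    -- The letters s, …, c are monotone and cannot be extended to the left.  The
    -- only admissible single letter is π₁, which counts as increasing.
    record OpenRun (d : Bool) (s c : ℕ) : Set where
      field
        s≤c   : s ≤ c
        steps : ∀ i → s ≤ i → i < c → δ i ≡ d
        start : ∀ i → suc i ≡ s → δ i ≡ not d
        size  : s < c ⊎ (s ≡ 0 × c ≡ 0 × d ≡ false)

    open OpenRun

    -- An open run that cannot be extended to the right either. `stop` is guarded because δ has only
    -- a default value behind the last step.
    record Run (I : Interval) : Set where
      constructor run
      field
        {d}     : Bool
        {c}     : ℕ
        end     : proj₂ I ≡ suc c
        openRun : OpenRun d (proj₁ I) c
        c<n     : c < n
        stop    : suc c < n → δ c ≡ not d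

    -- The step into letter c decides the direction. At c = 0 only the one-letter run remains, and
    -- it counts as increasing.
    direction-unique : ∀ {d d′ s s′ c} → OpenRun d s c → OpenRun d′ s′ c → d ≡ d′
    direction-unique {c = zero} r r′ with size r | size r′
    ... | inj₁ () | _
    ... | inj₂ _ | inj₁ ()
    ... | inj₂ (_ , _ , d≡) | inj₂ (_ , _ , d′≡) = trans d≡ (sym d′≡)
    direction-unique {c = suc c} r r′ with size r | size r′
    ... | inj₂ (_ , () , _) | _
    ... | inj₁ _ | inj₂ (_ , () , _)
    ... | inj₁ (s≤s s≤c) | inj₁ (s≤s s′≤c) =
      trans (sym (steps r c s≤c ℕ.≤-refl)) (steps r′ c s′≤c ℕ.≤-refl)

    -- The step just before the later start would have both directions. So at most one open run
    -- reaches a given letter, which lets runs be identified by their ends.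
    ¬start< : ∀ {d s s′ c} → OpenRun d s c → OpenRun d s′ c → ¬ s < s′
    ¬start< {s′ = suc i} r r′ (s≤s s≤i) = not-¬ refl (trans (sym (steps r i s≤i (s≤c r′))) (start r′ i refl))

    start-unique : ∀ {d d′ s s′ c} → OpenRun d s c → OpenRun d′ s′ c → s ≡ s′
    start-unique {s = s} {s′} r r′ with refl ← direction-unique r r′ with ℕ.<-cmp s s′
    ... | tri< s<s′ _ _ = contradiction s<s′ (¬start< r r′)
    ... | tri≈ _ s≡s′ _ = s≡s′
    ... | tri> _ _ s′<s = contradiction s′<s (¬start< r′ r)

    initial : OpenRun false 0 0
    initial = record { s≤c = z≤n ; steps = λ _ _ () ; start = λ _ () ; size = inj₂ (refl , refl , refl) }

    continue : ∀ {d s c} → OpenRun d s c → δ c ≡ d → OpenRun d s (suc c)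
    continue {d} {s} {c} r δc = record
      { s≤c   = ℕ.m≤n⇒m≤1+n (s≤c r)
      ; steps = λ i s≤i i<1+c → [ steps r i s≤i , (λ { refl → δc }) ]′ (ℕ.m≤n⇒m<n∨m≡n (ℕ.≤-pred i<1+c))
      ; start = start r
      ; size  = inj₁ (s≤s (s≤c r))
      }

    turn : ∀ {d s c} → OpenRun d s c → δ c ≡ not d → OpenRun (not d) c (suc c)
    turn {d} {s} {c} r δc = record
      { s≤c   = ℕ.n≤1+n c
      ; steps = λ i c≤i i<1+c → trans (cong δ (ℕ.≤-antisym (ℕ.≤-pred i<1+c) c≤i)) δc
      ; start = λ i 1+i≡c → trans (before i 1+i≡c (size r)) (sym (not-involutive d))
      ; size  = inj₁ ℕ.≤-refl
      }
      where
      before : ∀ i → suc i ≡ c → s < c ⊎ (s ≡ 0 × c ≡ 0 × d ≡ false) → δ i ≡ d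
      before i refl (inj₁ (s≤s s≤i)) = steps r i s≤i ℕ.≤-refl

    -- `agree` ranges over all i, the default value of `at` included, so that passing to the tail
    -- needs no bounds.
    record Suffix (c : ℕ) (ds : List Bool) : Set where
      constructor _,_
      field
        length≡ : n ≡ suc (c ℕ.+ length ds)
        agree   : ∀ i → δ (c ℕ.+ i) ≡ at ds i

    Suffix-tail : ∀ {c e ds} → Suffix c (e ∷ ds) → Suffix (suc c) ds
    Suffix-tail {c} (n≡ , δ≡) =
      trans n≡ (cong suc (ℕ.+-suc c _)) , λ i → trans (cong δ (sym (ℕ.+-suc c i))) (δ≡ (suc i))

    Suffix-head : ∀ {c e ds} → Suffix c (e ∷ ds) → δ c ≡ e
    Suffix-head {c} (_ , δ≡) = trans (cong δ (sym (ℕ.+-identityʳ c))) (δ≡ 0)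

    Suffix-< : ∀ {c ds} → Suffix c ds → c < n
    Suffix-< {c} (n≡ , _) = subst (c <_) (sym n≡) (s≤s (ℕ.m≤m+n c _))

    runsFrom-sound : ∀ {d s c} ds → OpenRun d s c → Suffix c ds → All Run (runsFrom d s c ds)
    runsFrom-sound {c = c} [] r suffix@(n≡ , _) =
      run refl r (Suffix-< suffix) (λ 1+c<n → contradiction
        (trans n≡ (cong suc (ℕ.+-identityʳ c))) (ℕ.>⇒≢ 1+c<n)) ∷ []
    runsFrom-sound {false} (false ∷ ds) r suffix =
      runsFrom-sound ds (continue r (Suffix-head suffix)) (Suffix-tail suffix)
    runsFrom-sound {false} (true ∷ ds) r suffix =
      run refl r (Suffix-< suffix) (const (Suffix-head suffix)) ∷
      runsFrom-sound ds (turn r (Suffix-head suffix)) (Suffix-tail suffix)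
    runsFrom-sound {true} (false ∷ ds) r suffix =
      run refl r (Suffix-< suffix) (const (Suffix-head suffix)) ∷
      runsFrom-sound ds (turn r (Suffix-head suffix)) (Suffix-tail suffix)
    runsFrom-sound {true} (true ∷ ds) r suffix =
      runsFrom-sound ds (continue r (Suffix-head suffix)) (Suffix-tail suffix)

    stops-here : ∀ {d s c} ds → OpenRun d s c → Suffix c (not d ∷ ds) → ∀ {I} → Run I → proj₂ I ≡ suc c →
                 I ≡ (s , suc c)
    stops-here ds r suffix (run refl r′ _ _) refl = cong (_, _) (start-unique r′ r)

    continues : ∀ {d s c} ds → OpenRun d s c → Suffix c (d ∷ ds) → ∀ {I} → Run I → proj₂ I ≢ suc c
    continues ds r suffix (run refl r′ _ stop) refl with refl ← direction-unique r r′ =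
      not-¬ (Suffix-head suffix) (stop (Suffix-< (Suffix-tail suffix)))

    -- At each letter either the open run stops, and by uniqueness no other run ends there, or it
    -- continues, and no run ends there at all.
    runsFrom-complete : ∀ {d s c} ds → OpenRun d s c → Suffix c ds →
                        ∀ {I} → Run I → c < proj₂ I → I ∈ runsFrom d s c ds
    runsFrom-complete {c = c} [] r (n≡ , _) (run refl r′ c′<n _) c<
      with refl ← ℕ.≤-antisym (ℕ.≤-pred c<)
                    (ℕ.≤-pred (subst (_ ≤_) (trans n≡ (cong suc (ℕ.+-identityʳ c))) c′<n)) =
      here (cong (_, _) (start-unique r′ r))
    runsFrom-complete {false} (false ∷ ds) r suffix I c< =
      runsFrom-complete ds (continue r (Suffix-head suffix)) (Suffix-tail suffix) I
        (ℕ.≤∧≢⇒< c< (continues ds r suffix I ∘ sym))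
    runsFrom-complete {false} {c = c} (true ∷ ds) r suffix {_ , b} I c< with b ℕ.≟ suc c
    ... | yes b≡ = here (stops-here ds r suffix I b≡)
    ... | no  b≢ = there (runsFrom-complete ds (turn r (Suffix-head suffix)) (Suffix-tail suffix) I (ℕ.≤∧≢⇒< c< (b≢ ∘ sym)))
    runsFrom-complete {true} {c = c} (false ∷ ds) r suffix {_ , b} I c< with b ℕ.≟ suc c
    ... | yes b≡ = here (stops-here ds r suffix I b≡)
    ... | no  b≢ = there (runsFrom-complete ds (turn r (Suffix-head suffix)) (Suffix-tail suffix) I (ℕ.≤∧≢⇒< c< (b≢ ∘ sym)))
    runsFrom-complete {true} (true ∷ ds) r suffix I c< =
      runsFrom-complete ds (continue r (Suffix-head suffix)) (Suffix-tail suffix) I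
        (ℕ.≤∧≢⇒< c< (continues ds r suffix I ∘ sym))

  -- Monotone factors in terms of directions, and the count of up-down runs.

  directions : List ℕ → List Bool
  directions []      = []
  directions (p ∷ w) = descents p w

  Step : Bool → ℕ → ℕ → Set
  Step false = _<_
  Step true  = ℕ._>_

  Step⇒descent : ∀ d {p q} → Step d p q → descent p q ≡ d
  Step⇒descent false p<q = dec-false (_ ℕ.<? _) (ℕ.<⇒≯ p<q)
  Step⇒descent true  q<p = dec-true (_ ℕ.<? _) q<p

  descent⇒Step : ∀ {p q} → p ≢ q → Step (descent p q) p q
  descent⇒Step {p} {q} p≢q with q ℕ.<? p
  ... | yes q<p = subst (λ d → Step d p q) (sym (Step⇒descent true q<p)) q<p
  ... | no  q≮p = subst (λ d → Step d p q) (sym (Step⇒descent false p<q)) p<q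
    where p<q = ℕ.≤∧≢⇒< (ℕ.≮⇒≥ q≮p) p≢q

  Linked⇒at : ∀ d k w → Linked (Step d) (take k w) → k ≤ length w → ∀ i → suc i < k → at (directions w) i ≡ d
  Linked⇒at d (suc (suc k)) (p ∷ q ∷ w) (s ∷ l) _ zero _ = Step⇒descent d s
  Linked⇒at d (suc (suc k)) (p ∷ q ∷ w) (s ∷ l) (s≤s k≤) (suc i) (s≤s i<) = Linked⇒at d (suc k) (q ∷ w) l k≤ i i<
  Linked⇒at d (suc (suc k)) (p ∷ []) l (s≤s ()) i _
  Linked⇒at d (suc zero) w l _ i (s≤s ())

  at⇒Linked : ∀ d k w → Linked _≢_ w → (∀ i → suc i < k → at (directions w) i ≡ d) → Linked (Step d) (take k w)
  at⇒Linked d zero          w           _         _ = []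
  at⇒Linked d (suc k)       []          _         _ = []
  at⇒Linked d (suc zero)    (p ∷ w)     _         _ = [-]
  at⇒Linked d (suc (suc k)) (p ∷ [])    _         _ = [-]
  at⇒Linked d (suc (suc k)) (p ∷ q ∷ w) (p≢q ∷ l) h =
    subst (λ d → Step d p q) (h 0 (s≤s (s≤s z≤n))) (descent⇒Step p≢q) ∷
    at⇒Linked d (suc k) (q ∷ w) l (λ i i< → h (suc i) (s≤s i<))

  at-drop : ∀ a w i → at (directions (drop a w)) i ≡ at (directions w) (a ℕ.+ i)
  at-drop zero    w           i = refl
  at-drop (suc a) []          i = refl
  at-drop (suc a) (p ∷ [])    i = cong (λ w → at (directions w) i) (drop-[] a)
  at-drop (suc a) (p ∷ q ∷ w) i = at-drop a (q ∷ w) i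

  Linked-drop : ∀ a {w : List ℕ} → Linked _≢_ w → Linked _≢_ (drop a w)
  Linked-drop zero    l         = l
  Linked-drop (suc a) []        = []
  Linked-drop (suc a) [-]       = Linked-drop a []
  Linked-drop (suc a) (_ ∷ l)   = Linked-drop a l

  module _ (π : List ℕ) (π! : Unique π) where

    private
      δ = at (directions π)
      n = length π

    open Runs δ n
    open OpenRun

    Directed : Bool → Interval → Set
    Directed d I = ∀ i → proj₁ I ≤ i → suc i < proj₂ I → δ i ≡ d

    Linked⇒Directed : ∀ d {a b} → b ≤ n → Linked (Step d) (factor π (a , b)) → Directed d (a , b)
    Linked⇒Directed d {a} {b} b≤n l i a≤i 1+i<b =
      trans (cong δ (sym (ℕ.m+[n∸m]≡n a≤i))) (trans (sym (at-drop a π (i ∸ a)))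
        (Linked⇒at d (b ∸ a) (drop a π) l
          (ℕ.≤-trans (ℕ.∸-monoˡ-≤ a b≤n) (ℕ.≤-reflexive (sym (length-drop a π))))
          (i ∸ a) (subst (_< b ∸ a) (ℕ.+-∸-assoc 1 a≤i) (ℕ.∸-monoˡ-< 1+i<b (ℕ.m≤n⇒m≤1+n a≤i)))))

    Directed⇒Linked : ∀ d {a b} → a ≤ b → Directed d (a , b) → Linked (Step d) (factor π (a , b))
    Directed⇒Linked d {a} {b} a≤b h = at⇒Linked d (b ∸ a) (drop a π) (Linked-drop a (AllPairs⇒Linked π!))
      (λ i 1+i< → trans (at-drop a π i) (h (a ℕ.+ i) (ℕ.m≤m+n a i)
        (subst (_≤ b) (trans (ℕ.+-comm (suc (suc i)) a) (trans (ℕ.+-suc a _) (cong suc (ℕ.+-suc a i))))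
          (ℕ.m≤o∸n⇒m+n≤o (suc (suc i)) a≤b 1+i<))))

    Monotone⇒Directed : ∀ {a b} → b ≤ n → Monotone (factor π (a , b)) → ∃[ d ] Directed d (a , b)
    Monotone⇒Directed b≤n (inj₁ inc) = false , Linked⇒Directed false b≤n inc
    Monotone⇒Directed b≤n (inj₂ dec) = true , Linked⇒Directed true b≤n dec

    Directed⇒Monotone : ∀ d {a b} → a ≤ b → Directed d (a , b) → Monotone (factor π (a , b))
    Directed⇒Monotone false a≤b h = inj₁ (Directed⇒Linked false a≤b h)
    Directed⇒Monotone true  a≤b h = inj₂ (Directed⇒Linked true a≤b h)

    length-factor : ∀ a {b} → b ≤ n → length (factor π (a , b)) ≡ b ∸ a
    length-factor a {b} b≤n = trans (length-take (b ∸ a) (drop a π)) (trans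
      (cong ((b ∸ a) ℕ.⊓_) (length-drop a π)) (ℕ.m≤n⇒m⊓n≡m (ℕ.∸-monoˡ-≤ a b≤n)))

    -- A longer interval would contain the step before a or the step after letter c, and both have
    -- the opposite direction.
    directed-maximal : ∀ {d a c J} → OpenRun d a c → (suc c < n → δ c ≡ not d) → c < n →
      J ∈ intervals n → (a , suc c) ⊑ J → Directed d J → J ≡ (a , suc c)
    directed-maximal {d} {a} {c} {a′ , b′} r stop c<n J∈ (a′≤a , c<b′) h = cong₂ _,_
      ([ (λ a′<a → contradiction a′<a (left a refl)) , id ]′ (ℕ.m≤n⇒m<n∨m≡n a′≤a))
      ([ (λ 1+c<b′ → contradiction (stop (ℕ.≤-trans 1+c<b′ b′≤n)) (not-¬ (h c (ℕ.≤-trans a′≤a (s≤c r)) 1+c<b′)))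
       , sym ]′ (ℕ.m≤n⇒m<n∨m≡n c<b′))
      where
      b′≤n = proj₂ (∈-intervals⁻ n J∈)
      left : ∀ s → s ≡ a → ¬ a′ < s
      left (suc i) refl (s≤s a′≤i) =
        not-¬ (h i a′≤i (ℕ.≤-trans (s≤s (s≤c r)) c<b′)) (start r i refl)

    Run⇒Directed : ∀ {d a c} → OpenRun d a c → Directed d (a , suc c)
    Run⇒Directed r i a≤i (s≤s i<c) = steps r i a≤i i<c

    Run⇒UpDownRun : ∀ {I} → Run I → UpDownRun π I
    Run⇒UpDownRun {a , _} (run {d} {c} refl r c<n stop) with size r
    ... | inj₁ a<c = inj₁
      ((Directed⇒Monotone d (ℕ.m≤n⇒m≤1+n (s≤c r)) (Run⇒Directed r) , All.tabulate maximal) ,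
       subst (2 ≤_) (sym (trans (length-factor a c<n) (ℕ.+-∸-assoc 1 (s≤c r)))) (s≤s (ℕ.m<n⇒0<n∸m a<c)))
      where
      maximal : ∀ {J} → J ∈ intervals n → (a , suc c) ⊑ J → Monotone (factor π J) → J ≡ (a , suc c)
      maximal J∈ I⊑J@(a′≤a , c<b′) mono with d′ , h ← Monotone⇒Directed (proj₂ (∈-intervals⁻ n J∈)) mono
        -- The interval has at least one step, and J contains it, so J has the same direction.
        with refl ← trans (sym (steps r a ℕ.≤-refl a<c)) (h a a′≤a (ℕ.≤-trans (s≤s a<c) c<b′)) =
        directed-maximal r stop c<n J∈ I⊑J h
    -- A one-letter run has to be maximal among increasing factors only, so no direction of J has to
    -- be determined.
    ... | inj₂ (refl , refl , refl) = inj₂ (refl , Directed⇒Linked false z≤n (Run⇒Directed r) , All.tabulate maximal)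
      where
      maximal : ∀ {J} → J ∈ intervals n → (0 , 1) ⊑ J → Increasing (factor π J) → J ≡ (0 , 1)
      maximal J∈ I⊑J inc =
        directed-maximal r stop c<n J∈ I⊑J (Linked⇒Directed false (proj₂ (∈-intervals⁻ n J∈)) inc)

    module _ {d a c} (c<n : c < n) (h : Directed d (a , suc c))
      (maximal : ∀ {J} → J ∈ intervals n → (a , suc c) ⊑ J → Directed d J → J ≡ (a , suc c))
      where

      -- Otherwise the interval with one more letter on the left would still be directed, against
      -- maximality; `maximal-stop` is the same on the right.
      maximal-start : a ≤ c → ∀ i → suc i ≡ a → δ i ≡ not d
      maximal-start a≤c i refl = ¬-not λ δi≡d → contradiction
        (maximal (∈-intervals⁺ (ℕ.m≤n⇒m≤1+n a≤c) c<n) (ℕ.n≤1+n i , ℕ.≤-refl)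
          (λ j i≤j 1+j<b → [ (λ i<j → h j i<j 1+j<b) , (λ { refl → δi≡d }) ]′ (ℕ.m≤n⇒m<n∨m≡n i≤j)))
        (ℕ.<⇒≢ ℕ.≤-refl ∘ cong proj₁)

      maximal-stop : a ≤ c → suc c < n → δ c ≡ not d
      maximal-stop a≤c 1+c<n = ¬-not λ δc≡d → contradiction
        (maximal (∈-intervals⁺ (s≤s (ℕ.m≤n⇒m≤1+n a≤c)) 1+c<n) (ℕ.≤-refl , ℕ.n≤1+n (suc c))
          (λ j a≤j 1+j<b → [ h j a≤j , (λ { refl → δc≡d }) ]′ (ℕ.m≤n⇒m<n∨m≡n (ℕ.≤-pred 1+j<b))))
        (ℕ.>⇒≢ ℕ.≤-refl ∘ cong proj₂)

    UpDownRun⇒Run : ∀ {I} → I ∈ intervals n → UpDownRun π I → Run I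
    UpDownRun⇒Run {a , zero} I∈ _ = contradiction (proj₁ (∈-intervals⁻ n I∈)) λ ()
    UpDownRun⇒Run {a , suc c} I∈ (inj₁ ((mono , max) , long))
      with s≤s a≤c , c<n ← ∈-intervals⁻ n I∈ with d , h ← Monotone⇒Directed c<n mono =
      run refl (record
        { s≤c = a≤c
        ; steps = λ i a≤i i<c → h i a≤i (s≤s i<c)
        ; start = maximal-start c<n h maximal a≤c
        ; size = inj₁ (ℕ.≤-pred (ℕ.m≤o∸n⇒m+n≤o 2 (ℕ.m≤n⇒m≤1+n a≤c) (subst (2 ≤_) (length-factor a c<n) long)))
        }) c<n (maximal-stop c<n h maximal a≤c)
      where
      maximal : ∀ {J} → J ∈ intervals n → (a , suc c) ⊑ J → Directed _ J → J ≡ (a , suc c)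
      maximal J∈ I⊑J h = All.lookup max J∈ I⊑J (Directed⇒Monotone _ (ℕ.<⇒≤ (proj₁ (∈-intervals⁻ n J∈))) h)
    UpDownRun⇒Run I∈ (inj₂ (refl , inc , max)) with _ , 0<n ← ∈-intervals⁻ n I∈ =
      run refl initial 0<n (maximal-stop 0<n (Linked⇒Directed false 0<n inc) maximal z≤n)
      where
      maximal : ∀ {J} → J ∈ intervals n → (0 , 1) ⊑ J → Directed false J → J ≡ (0 , 1)
      maximal J∈ I⊑J h = All.lookup max J∈ I⊑J (Directed⇒Linked false (ℕ.<⇒≤ (proj₁ (∈-intervals⁻ n J∈))) h)

  length-descents : ∀ p w → length (descents p w) ≡ length w
  length-descents p []      = refl
  length-descents p (q ∷ w) = cong suc (length-descents q w)

  -- The filtered intervals and `runsFrom` are lists without repetition and with the same members,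
  -- hence equally long.
  udr≡runs : ∀ p w → Unique (p ∷ w) → udr (p ∷ w) ≡ suc (turns false (descents p w))
  udr≡runs p w π! = trans
    (↭-length (unique∧set⇒↭ (Unique.filter⁺ (upDownRun? π) (intervals-unique (length π)))
      (runsFrom-unique false 0 0 ds) complete sound))
    (length-runsFrom false 0 0 ds)
    where
    π  = p ∷ w
    ds = descents p w
    open Runs (at ds) (length π)
    suffix : Suffix 0 ds
    suffix = cong suc (sym (length-descents p w)) , λ _ → refl
    sound : ∀ {I} → I ∈ runsFrom false 0 0 ds → I ∈ filter (upDownRun? π) (intervals (length π))
    sound I∈ with r@(run refl o c<n _) ← All.lookup (runsFrom-sound ds initial suffix) I∈ =
      ∈-filter⁺ (upDownRun? π) (∈-intervals⁺ (s≤s (OpenRun.s≤c o)) c<n) (Run⇒UpDownRun π π! r)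
    complete : ∀ {I} → I ∈ filter (upDownRun? π) (intervals (length π)) → I ∈ runsFrom false 0 0 ds
    complete I∈ with I∈′ , udr ← ∈-filter⁻ (upDownRun? π) {xs = intervals (length π)} I∈ =
      runsFrom-complete ds initial suffix (UpDownRun⇒Run π π! I∈′ udr)
        (ℕ.≤-trans (s≤s z≤n) (proj₁ (∈-intervals⁻ (length π) I∈′)))

open Words
open import Defs using (𝔖; 𝔅; udr; fdes)

-- From homogeneous polynomials back to sums over permutations.

module Evaluation {c ℓ} (R : CommutativeSemiring c ℓ) where
  open CommutativeSemiring R
  open Exp semiring using (_^_; ^-congˡ; ^-homo-*)
  open CommExp R using (^-distrib-*)
  open Sum R
  open Polynomials R
  open import Algebra.Properties.CommutativeSemigroup *-commutativeSemigroup using (xy∙z≈zx∙y)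
  open import Relation.Binary.Reasoning.Setoid setoid

  ∑𝔅 ∑𝔖 : ℕ → Carrier → Carrier
  ∑𝔅 n x = ∑ (𝔅 n) (λ π → x ^ fdes π)
  ∑𝔖 n x = ∑ (𝔖 n) (λ π → x ^ udr π)

  1^ : ∀ n → 1# ^ n ≈ 1#
  1^ zero    = refl
  1^ (suc n) = trans (*-identityˡ (1# ^ n)) (1^ n)

  x*∑𝔅≈flagPoly : ∀ n x → x * ∑𝔅 n x ≈ flagPoly n x 1#
  x*∑𝔅≈flagPoly n x = begin
    x * ∑ (𝔅 n) (λ π → x ^ fdes π)
      ≈⟨ *-∑ x (𝔅 n) ⟩
    ∑ (𝔅 n) (λ π → x ^ suc (fdes π))
      ≈⟨ ∑-↭ (Signed.𝔅↭enumeration n) ⟩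
    ∑ (Signed.enumeration n) (λ π → x ^ suc (fdes π))
      ≈⟨ ∑-cong′ (Signed.enumeration n) monomial ⟩
    ∑ (Signed.enumeration n) (λ π → flagMonomial x 1# (Signed.descents 0ℤ π))
      ≡⟨ ∑-map (Signed.descents 0ℤ) (Signed.enumeration n) ⟨
    ∑ (map (Signed.descents 0ℤ) (Signed.enumeration n)) (flagMonomial x 1#)
      ≡⟨ ≡.cong (λ ws → ∑ ws (flagMonomial x 1#)) (Signed.descents-enumeration ≡.refl (λ _ → ≡.refl) n) ⟩
    flagPoly n x 1# ∎
    where
    monomial : ∀ π → x ^ suc (fdes π) ≈ flagMonomial x 1# (Signed.descents 0ℤ π)
    monomial π = begin
      x ^ suc (fdes π)                       ≡⟨ ≡.cong (λ k → x ^ suc k) (Signed.fdes≡flagDescents π) ⟩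
      x ^ suc (flagDescents ds)              ≈⟨ *-identityʳ _ ⟨
      x ^ suc (flagDescents ds) * 1#         ≈⟨ *-congˡ (1^ (suc (flagAscents ds))) ⟨
      flagMonomial x 1# ds                   ∎
      where ds = Signed.descents 0ℤ π

  -- Dehomogenization without division: z plays the role of x / y, and y^(n + 1) clears all
  -- denominators because both exponents of each monomial add up to n + 1.
  yⁿ*∑𝔖≈udrPoly : ∀ n {x y z} → z * y ≈ x → y ^ suc n * ∑𝔖 (suc n) z ≈ udrPoly (suc n) x y
  yⁿ*∑𝔖≈udrPoly n {x} {y} {z} zy≈x = begin
    y ^ suc n * ∑ (𝔖 (suc n)) (λ π → z ^ udr π)
      ≈⟨ *-∑ (y ^ suc n) (𝔖 (suc n)) ⟩
    ∑ (𝔖 (suc n)) (λ π → y ^ suc n * z ^ udr π)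
      ≈⟨ ∑-↭ (Unsigned.𝔖↭enumeration (suc n)) ⟩
    ∑ (Unsigned.enumeration (suc n)) (λ π → y ^ suc n * z ^ udr π)
      ≈⟨ ∑-cong (All.map monomial (Unsigned.enumeration-sound (suc n))) ⟩
    ∑ (Unsigned.enumeration (suc n)) (λ π → udrMonomial x y (Unsigned.descents 0 π))
      ≡⟨ ∑-map (Unsigned.descents 0) (Unsigned.enumeration (suc n)) ⟨
    ∑ (map (Unsigned.descents 0) (Unsigned.enumeration (suc n))) (udrMonomial x y)
      ≡⟨ ≡.cong (λ ws → ∑ ws (udrMonomial x y)) (Unsigned.descents-enumeration ≡.refl (λ _ → ≡.refl) (suc n)) ⟩
    udrPoly (suc n) x y ∎
    where
    monomial : ∀ {π} → Unsigned.Perm (suc n) π → y ^ suc n * z ^ udr π ≈ udrMonomial x y (Unsigned.descents 0 π)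
    monomial {p ∷ w} (len , _ , π!) = begin
      y ^ suc n * z ^ udr (p ∷ w)   ≡⟨ ≡.cong₂ (λ m k → y ^ m * z ^ k) 1+n≡r+s (udr≡runs p w (Unique.map⁻ π!)) ⟩
      y ^ (r ℕ.+ s) * z ^ r         ≈⟨ *-congʳ (^-homo-* y r s) ⟩
      (y ^ r * y ^ s) * z ^ r       ≈⟨ xy∙z≈zx∙y (y ^ r) (y ^ s) (z ^ r) ⟩
      (z ^ r * y ^ r) * y ^ s       ≈⟨ *-congʳ (^-distrib-* z y r) ⟨
      (z * y) ^ r * y ^ s           ≈⟨ *-congʳ (^-congˡ r zy≈x) ⟩
      x ^ r * y ^ s                 ∎
      where
      ds = Unsigned.descents p w
      r = suc (turns false ds)
      s = stays false ds
      1+n≡r+s : suc n ≡ r ℕ.+ s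
      1+n≡r+s = ≡.trans (≡.sym len) (≡.cong suc (≡.sym (≡.trans (turns+stays false ds) (length-descents p w))))

  -- The form from which both identities follow, with z for 2x / (1 + x²). `2#` and `y` are
  -- variables because the constant 2 of `K` is only equivalent, not identical, to `1# + 1#`.
  2x*∑𝔅≈[1+x]yⁿ*∑𝔖 : ∀ n {2# x y z} → 2# ≈ 1# + 1# → y ≈ 1# + x ^ 2 → z * y ≈ 2# * x →
    (2# * x) * ∑𝔅 (suc n) x ≈ ((1# + x) * y ^ suc n) * ∑𝔖 (suc n) z
  2x*∑𝔅≈[1+x]yⁿ*∑𝔖 n {2#} {x} {y} {z} 2≈ y≈ zy≈ = begin
    (2# * x) * ∑𝔅 (suc n) x
      ≈⟨ *-assoc 2# x _ ⟩
    2# * (x * ∑𝔅 (suc n) x)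
      ≈⟨ *-cong 2≈ (x*∑𝔅≈flagPoly (suc n) x) ⟩
    (1# + 1#) * flagPoly (suc n) x 1#
      ≈⟨ 2*flagPoly R n x 1# ⟩
    (x + 1#) * udrPoly (suc n) ((1# + 1#) * (x * 1#)) (x * x + 1# * 1#)
      ≈⟨ *-cong (+-comm x 1#) (udrPoly-cong (suc n) (*-cong (sym 2≈) (*-identityʳ x)) (begin
           x * x + 1# * 1#   ≈⟨ +-comm _ _ ⟩
           1# * 1# + x * x   ≈⟨ +-cong (*-identityʳ 1#) (*-congˡ (sym (*-identityʳ x))) ⟩
           1# + x ^ 2        ≈⟨ y≈ ⟨
           y                 ∎)) ⟩
    (1# + x) * udrPoly (suc n) (2# * x) y
      ≈⟨ *-congˡ (yⁿ*∑𝔖≈udrPoly n zy≈) ⟨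
    (1# + x) * (y ^ suc n * ∑𝔖 (suc n) z)
      ≈⟨ *-assoc _ _ _ ⟨
    ((1# + x) * y ^ suc n) * ∑𝔖 (suc n) z ∎

-- Power series and their fractions

open import Defs

-- Pointwise equality, wrapped in a record so that f and g can be inferred.
infix 4 _≐_
record _≐_ (f g : Series) : Set where
  constructor pointwise
  field coefficient : ∀ n → f n ≡ g n

open _≐_

sumTo-cong : ∀ n {g h : ℕ → ℚ} → (∀ i → g i ≡ h i) → sumTo n g ≡ sumTo n h
sumTo-cong zero    g≡h = g≡h 0
sumTo-cong (suc n) g≡h = ≡.cong₂ ℚ._+_ (g≡h 0) (sumTo-cong n (g≡h ∘ suc))

⊛-cong : ∀ {f f′ g g′} → f ≐ f′ → g ≐ g′ → f ⊛ g ≐ f′ ⊛ g′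
⊛-cong f≐ g≐ = pointwise λ n →
  sumTo-cong n (λ i → ≡.cong₂ ℚ._*_ (coefficient f≐ i) (coefficient g≐ (n ∸ i)))

-- `⊛-last` splits off the last term of one product, while the definition splits off the first term
-- of the other.
⊛-comm : ∀ f g n → (f ⊛ g) n ≡ (g ⊛ f) n
⊛-comm f g zero    = ℚ.*-comm (f 0) (g 0)
⊛-comm f g (suc n) = begin
  (f ⊛ g) (suc n)                         ≡⟨ ⊛-last f g n ⟩
  (f ⊛ tail g) n ℚ.+ f (suc n) ℚ.* g 0    ≡⟨ ≡.cong₂ ℚ._+_ (⊛-comm f (tail g) n) (ℚ.*-comm (f (suc n)) (g 0)) ⟩
  (tail g ⊛ f) n ℚ.+ g 0 ℚ.* f (suc n)    ≡⟨ ℚ.+-comm ((tail g ⊛ f) n) (g 0 ℚ.* f (suc n)) ⟩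
  (g ⊛ f) (suc n)                         ∎
  where open ≡.≡-Reasoning

⊛-distribʳ : ∀ h f g n → ((f ⊕ g) ⊛ h) n ≡ (f ⊛ h) n ℚ.+ (g ⊛ h) n
⊛-distribʳ h f g zero    = ℚ.*-distribʳ-+ (h 0) (f 0) (g 0)
⊛-distribʳ h f g (suc n) = begin
  (f 0 ℚ.+ g 0) ℚ.* h (suc n) ℚ.+ ((tail f ⊕ tail g) ⊛ h) n
    ≡⟨ ≡.cong₂ ℚ._+_ (ℚ.*-distribʳ-+ (h (suc n)) (f 0) (g 0)) (⊛-distribʳ h (tail f) (tail g) n) ⟩
  (f 0 ℚ.* h (suc n) ℚ.+ g 0 ℚ.* h (suc n)) ℚ.+ ((tail f ⊛ h) n ℚ.+ (tail g ⊛ h) n)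
    ≡⟨ interchange (f 0 ℚ.* h (suc n)) (g 0 ℚ.* h (suc n)) ((tail f ⊛ h) n) ((tail g ⊛ h) n) ⟩
  (f ⊛ h) (suc n) ℚ.+ (g ⊛ h) (suc n) ∎
  where
  open ≡.≡-Reasoning
  open import Algebra.Properties.CommutativeSemigroup (CommutativeRing.+-commutativeSemigroup ℚ.+-*-commutativeRing) using (interchange)

⊛-scale : ∀ c f g n → ((λ i → c ℚ.* f i) ⊛ g) n ≡ c ℚ.* (f ⊛ g) n
⊛-scale c f g zero    = ℚ.*-assoc c (f 0) (g 0)
⊛-scale c f g (suc n) = ≡.trans
  (≡.cong₂ ℚ._+_ (ℚ.*-assoc c (f 0) (g (suc n))) (⊛-scale c (tail f) g n))
  (≡.sym (ℚ.*-distribˡ-+ c _ _))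

⊛-assoc : ∀ f g h n → ((f ⊛ g) ⊛ h) n ≡ (f ⊛ (g ⊛ h)) n
⊛-assoc f g h zero    = ℚ.*-assoc (f 0) (g 0) (h 0)
⊛-assoc f g h (suc n) = begin
  -- By definition the tail of `f ⊛ g` is f 0 times the tail of g, plus `tail f ⊛ g`.
  (f 0 ℚ.* g 0) ℚ.* h (suc n) ℚ.+ (((λ i → f 0 ℚ.* g (suc i)) ⊕ tail f ⊛ g) ⊛ h) n
    ≡⟨ ≡.cong₂ ℚ._+_ (ℚ.*-assoc (f 0) (g 0) (h (suc n))) (⊛-distribʳ h (λ i → f 0 ℚ.* g (suc i)) (tail f ⊛ g) n) ⟩
  f 0 ℚ.* (g 0 ℚ.* h (suc n)) ℚ.+ (((λ i → f 0 ℚ.* g (suc i)) ⊛ h) n ℚ.+ ((tail f ⊛ g) ⊛ h) n)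
    ≡⟨ ≡.cong (f 0 ℚ.* (g 0 ℚ.* h (suc n)) ℚ.+_) (≡.cong₂ ℚ._+_ (⊛-scale (f 0) (tail g) h n) (⊛-assoc (tail f) g h n)) ⟩
  f 0 ℚ.* (g 0 ℚ.* h (suc n)) ℚ.+ (f 0 ℚ.* (tail g ⊛ h) n ℚ.+ (tail f ⊛ (g ⊛ h)) n)
    ≡⟨ ℚ.+-assoc (f 0 ℚ.* (g 0 ℚ.* h (suc n))) (f 0 ℚ.* (tail g ⊛ h) n) ((tail f ⊛ (g ⊛ h)) n) ⟨
  (f 0 ℚ.* (g 0 ℚ.* h (suc n)) ℚ.+ f 0 ℚ.* (tail g ⊛ h) n) ℚ.+ (tail f ⊛ (g ⊛ h)) n
    ≡⟨ ≡.cong (ℚ._+ (tail f ⊛ (g ⊛ h)) n) (ℚ.*-distribˡ-+ (f 0) _ _) ⟨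
  (f ⊛ (g ⊛ h)) (suc n) ∎
  where open ≡.≡-Reasoning

⊛-zeroˡ : ∀ f n → (𝟘 ⊛ f) n ≡ 0ℚ
⊛-zeroˡ f zero    = ℚ.*-zeroˡ (f 0)
⊛-zeroˡ f (suc n) = ≡.cong₂ ℚ._+_ (ℚ.*-zeroˡ (f (suc n))) (⊛-zeroˡ f n)

⊛-identityˡ : ∀ f n → (𝟙 ⊛ f) n ≡ f n
⊛-identityˡ f zero    = ℚ.*-identityˡ (f 0)
⊛-identityˡ f (suc n) = ≡.trans (≡.cong₂ ℚ._+_ (ℚ.*-identityˡ (f (suc n))) (⊛-zeroˡ f n)) (ℚ.+-identityʳ _)

seriesRing : CommutativeRing 0ℓ 0ℓ
seriesRing = record
  { Carrier = Series
  ; _≈_ = _≐_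
  ; _+_ = _⊕_
  ; _*_ = _⊛_
  ; -_  = ⊝_
  ; 0#  = 𝟘
  ; 1#  = 𝟙
  ; isCommutativeRing = record
    { isRing = record
      { +-isAbelianGroup = record
        { isGroup = record
          { isMonoid = record
            { isSemigroup = record
              { isMagma = record
                { isEquivalence = record
                  { refl  = pointwise λ _ → ≡.refl
                  ; sym   = λ f≐g → pointwise λ n → ≡.sym (coefficient f≐g n)
                  ; trans = λ f≐g g≐h → pointwise λ n → ≡.trans (coefficient f≐g n) (coefficient g≐h n)
                  }
                ; ∙-cong = λ f≐ g≐ → pointwise λ n → ≡.cong₂ ℚ._+_ (coefficient f≐ n) (coefficient g≐ n)
                }
              ; assoc = λ f g h → pointwise λ n → ℚ.+-assoc (f n) (g n) (h n)
              }
            ; identity = (λ f → pointwise λ n → ℚ.+-identityˡ (f n)) ,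
                         (λ f → pointwise λ n → ℚ.+-identityʳ (f n))
            }
          ; inverse = (λ f → pointwise λ n → ℚ.+-inverseˡ (f n)) ,
                      (λ f → pointwise λ n → ℚ.+-inverseʳ (f n))
          ; ⁻¹-cong = λ f≐ → pointwise λ n → ≡.cong ℚ.-_ (coefficient f≐ n)
          }
        ; comm = λ f g → pointwise λ n → ℚ.+-comm (f n) (g n)
        }
      ; *-cong = ⊛-cong
      ; *-assoc = λ f g h → pointwise (⊛-assoc f g h)
      ; *-identity = (λ f → pointwise (⊛-identityˡ f)) ,
                     (λ f → pointwise λ n → ≡.trans (⊛-comm f 𝟙 n) (⊛-identityˡ f n))
      ; distrib = (λ f g h → pointwise λ n → ≡.trans (⊛-comm f (g ⊕ h) n) (≡.trans (⊛-distribʳ f g h n)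
                    (≡.cong₂ ℚ._+_ (⊛-comm g f n) (⊛-comm h f n)))) ,
                  (λ f g h → pointwise (⊛-distribʳ f g h))
      }
    ; *-comm = λ f g → pointwise (⊛-comm f g)
    }
  }

module 𝕊 = CommutativeRing seriesRing

-- If f and g differed in a coefficient, `⊛-nonZero` would exhibit a nonzero coefficient of (f - g)
-- h, which vanishes. Equality in ℚ is decidable, so this settles each coefficient.
⊛-cancelʳ : ∀ {f g h} → NonZeroSeries h → f ⊛ h ≐ g ⊛ h → f ≐ g
⊛-cancelʳ {f} {g} {h} h≢0 fh≐gh = pointwise λ n → agree n
  where
  open import Algebra.Properties.Ring 𝕊.ring using (-‿distribˡ-*)
  open GroupProperties ℚ.+-0-group using (x∙y⁻¹≈ε⇒x≈y)
  difference≐0 : (f ⊕ (⊝ g)) ⊛ h ≐ 𝟘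
  difference≐0 = 𝕊.trans (𝕊.distribʳ h f (⊝ g)) (𝕊.trans (𝕊.+-cong fh≐gh (𝕊.sym (-‿distribˡ-* g h)))
    (𝕊.-‿inverseʳ (g ⊛ h)))
  agree : ∀ n → f n ≡ g n
  agree n with f n ℚ.≟ g n
  ... | yes fn≡gn = fn≡gn
  ... | no  fn≢gn with nz k c≢0 ← ⊛-nonZero {f ⊕ (⊝ g)} (nz n (fn≢gn ∘ x∙y⁻¹≈ε⇒x≈y (f n) (g n))) h≢0 =
    contradiction (coefficient difference≐0 k) c≢0

-- The commutative semiring of fractions.

open K
open FractionIdentities 𝕊.commutativeSemiring

infix 4 _≃_
record _≃_ (x y : K) : Set where
  constructor cross
  field crossMultiplied : num x ⊛ den y ≐ num y ⊛ den x

open _≃_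

≃⇒≈ : ∀ {x y} → x ≃ y → x ≈ y
≃⇒≈ x≃y = coefficient (crossMultiplied x≃y)

≃-trans : ∀ {x y z} → x ≃ y → y ≃ z → x ≃ z
≃-trans {x} {y} {z} (cross xy) (cross yz) = cross (⊛-cancelʳ (den≢0 y)
  (frac-trans (num x) (den x) (num y) (den y) (num z) (den z) xy yz))

fractionSemiring : CommutativeSemiring 0ℓ 0ℓ
fractionSemiring = record
  { Carrier = K
  ; _≈_ = _≃_
  ; _+_ = _+_
  ; _*_ = _*_
  ; 0# = 0#
  ; 1# = 1#
  ; isCommutativeSemiring = isCommutativeSemiringˡ record
    { +-isCommutativeMonoid = isCommutativeMonoidˡ record
      { isSemigroup = record
        { isMagma = record
          { isEquivalence = isEquivalence
          ; ∙-cong = λ {x} {y} {u} {v} x≃y u≃v → cross (frac-+-cong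
              (num x) (den x) (num y) (den y) (num u) (den u) (num v) (den v)
              (crossMultiplied x≃y) (crossMultiplied u≃v))
          }
        ; assoc = λ x y z → cross (frac-+-assoc (num x) (den x) (num y) (den y) (num z) (den z))
        }
      ; identityˡ = λ x → cross (frac-+-identityˡ (num x) (den x))
      ; comm = λ x y → cross (frac-+-comm (num x) (den x) (num y) (den y))
      }
    ; *-isCommutativeMonoid = isCommutativeMonoidˡ record
      { isSemigroup = record
        { isMagma = record
          { isEquivalence = isEquivalence
          ; ∙-cong = λ {x} {y} {u} {v} x≃y u≃v → cross (frac-*-cong
              (num x) (den x) (num y) (den y) (num u) (den u) (num v) (den v)
              (crossMultiplied x≃y) (crossMultiplied u≃v))
          }
        ; assoc = λ x y z → cross (frac-*-assoc (num x) (den x) (num y) (den y) (num z) (den z))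
        }
      ; identityˡ = λ x → cross (frac-*-identityˡ (num x) (den x))
      ; comm = λ x y → cross (frac-*-comm (num x) (den x) (num y) (den y))
      }
    ; distribʳ = λ x y z → cross (frac-distribʳ (num x) (den x) (num y) (den y) (num z) (den z))
    ; zeroˡ = λ x → cross (frac-zeroˡ (num x) (den x))
    }
  }
  where
  open import Relation.Binary.Structures using (IsEquivalence)
  isEquivalence : IsEquivalence _≃_
  isEquivalence = record
    { refl  = cross 𝕊.refl
    ; sym   = λ x≃y → cross (𝕊.sym (crossMultiplied x≃y))
    ; trans = ≃-trans
    }

/-* : ∀ x y y≢0 → x / y [ y≢0 ] * y ≃ x
/-* x y y≢0 = cross (frac-/-* (num x) (den x) (num y) (den y))

*-cancelʳ : ∀ {x y} z → NonZero z → x * z ≃ y * z → x ≃ y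
*-cancelʳ {x} {y} z z≢0 (cross xz≐yz) = cross (⊛-cancelʳ (⊛-nonZero z≢0 (den≢0 z))
  (frac-*-cancelʳ (num x) (den x) (num y) (den y) (num z) (den z) xz≐yz))

-- Evaluation at t and at v.

private module 𝕂 = CommutativeSemiring fractionSemiring

open Exp 𝕂.semiring using () renaming (_^_ to _^ᴷ_)
open Sum fractionSemiring using (∑-cong′)
open Evaluation fractionSemiring using (∑𝔅; ∑𝔖; 2x*∑𝔅≈[1+x]yⁿ*∑𝔖)
open CommutativeSemiringLemmas fractionSemiring using ([t[1+q²]]t≈[cq]t; quotient)

^≡^ᴷ : ∀ x n → x ^ n ≡ x ^ᴷ n
^≡^ᴷ x zero    = ≡.refl
^≡^ᴷ x (suc n) = ≡.cong (x *_) (^≡^ᴷ x n)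

F≃∑𝔅 : ∀ n x → F n x ≃ ∑𝔅 n x
F≃∑𝔅 n x = ∑-cong′ (𝔅 n) (λ π → 𝕂.reflexive (^≡^ᴷ x (fdes π)))

P^udr≃∑𝔖 : ∀ n x → P^udr n x ≃ ∑𝔖 n x
P^udr≃∑𝔖 n x = ∑-cong′ (𝔖 n) (λ π → 𝕂.reflexive (^≡^ᴷ x (udr π)))

2#≃1+1 : 2# ≃ 1# + 1#
2#≃1+1 = cross (𝕊.*-cong (𝕊.+-cong (𝕊.sym (𝕊.*-identityˡ 𝟙)) (𝕊.sym (𝕊.*-identityˡ 𝟙))) (𝕊.*-identityˡ 𝟙))

2x*F≃[1+x]yⁿ*P : ∀ n x y z → y ≃ 1# + x ^ 2 → z * y ≃ 2# * x →
  (2# * x) * F (suc n) x ≃ ((1# + x) * y ^ suc n) * P^udr (suc n) z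
2x*F≃[1+x]yⁿ*P n x y z y≃ zy≃ = begin
  (2# * x) * F (suc n) x
    ≈⟨ 𝕂.*-congˡ {2# * x} (F≃∑𝔅 (suc n) x) ⟩
  (2# * x) * ∑𝔅 (suc n) x
    ≈⟨ 2x*∑𝔅≈[1+x]yⁿ*∑𝔖 n {2#} {x} {y} {z} 2#≃1+1 y≃ zy≃ ⟩
  ((1# + x) * y ^ᴷ suc n) * ∑𝔖 (suc n) z
    ≡⟨ ≡.cong (λ yⁿ → ((1# + x) * yⁿ) * ∑𝔖 (suc n) z) (^≡^ᴷ y (suc n)) ⟨
  ((1# + x) * y ^ suc n) * ∑𝔖 (suc n) z
    ≈⟨ 𝕂.*-congˡ {(1# + x) * y ^ suc n} (P^udr≃∑𝔖 (suc n) z) ⟨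
  ((1# + x) * y ^ suc n) * P^udr (suc n) z ∎
  where open import Relation.Binary.Reasoning.Setoid 𝕂.setoid

≃-/ : ∀ x y a b b≢0 → b * x ≃ a * y → x ≃ a / b [ b≢0 ] * y
≃-/ x y a b b≢0 bx≃ay = *-cancelʳ b b≢0 (quotient (a / b [ b≢0 ]) a b x y (/-* a b b≢0) bx≃ay)

-- Fractions are treated only as a semiring, so the computation with the subtraction takes place in
-- ℚ[[t]] and is carried over along `ι`.
t²+[1-√]²≃2[1-√] : t * t + (1# - √1-t²) * (1# - √1-t²) ≃ 2# * (1# - √1-t²)
t²+[1-√]²≃2[1-√] = begin
  t * t + (1# - √1-t²) * (1# - √1-t²)
    ≈⟨ 𝕂.+-congˡ {t * t} (𝕂.*-cong 1-√ 1-√) ⟩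
  t * t + ι u * ι u
    ≈⟨ 𝕂.+-cong (ι-* 𝕥 𝕥) (ι-* u u) ⟩
  ι (𝕥 ⊛ 𝕥) + ι (u ⊛ u)
    ≈⟨ ι-+ (𝕥 ⊛ 𝕥) (u ⊛ u) ⟩
  ι (𝕥 ⊛ 𝕥 ⊕ u ⊛ u)
    ≈⟨ ι-cong (t²+u²≈2u 𝕥 u s (cancel s) s²+𝕥²≐1) ⟩
  ι (u ⊕ u)
    ≈⟨ ι-cong (𝕊.trans (𝕊.distribʳ u 𝟙 𝟙) (𝕊.+-cong (𝕊.*-identityˡ u) (𝕊.*-identityˡ u))) ⟨
  ι ((𝟙 ⊕ 𝟙) ⊛ u)
    ≈⟨ ι-* (𝟙 ⊕ 𝟙) u ⟨
  2# * ι u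
    ≈⟨ 𝕂.*-congˡ {2#} 1-√ ⟨
  2# * (1# - √1-t²) ∎
  where
  open CommutativeRingLemmas seriesRing
  open import Relation.Binary.Reasoning.Setoid 𝕂.setoid
  ι-cong : ∀ {f g} → f ≐ g → ι f ≃ ι g
  ι-cong f≐g = cross (𝕊.*-congʳ {𝟙} f≐g)
  ι-+ : ∀ f g → ι f + ι g ≃ ι (f ⊕ g)
  ι-+ f g = cross (𝕊.*-cong (𝕊.+-cong (𝕊.*-identityʳ f) (𝕊.*-identityʳ g)) (𝕊.sym (𝕊.*-identityʳ 𝟙)))
  ι-* : ∀ f g → ι f * ι g ≃ ι (f ⊛ g)
  ι-* f g = cross (𝕊.*-congˡ {f ⊛ g} (𝕊.sym (𝕊.*-identityʳ 𝟙)))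
  s u : Series
  s = sqrt (𝟙 ⊕ (⊝ (𝕥 ⊛ 𝕥)))
  u = 𝟙 ⊕ (⊝ s)
  1-√ : 1# - √1-t² ≃ ι u
  1-√ = cross (𝕊.*-cong (𝕊.+-cong (𝕊.*-identityʳ 𝟙) (𝕊.-‿cong (𝕊.*-identityʳ s))) (𝕊.sym (𝕊.*-identityʳ 𝟙)))
  cancel : ∀ f → (𝟙 ⊕ (⊝ f)) ⊕ f ≐ 𝟙
  cancel f = 𝕊.trans (𝕊.+-assoc 𝟙 (⊝ f) f) (𝕊.trans (𝕊.+-congˡ {𝟙} (𝕊.-‿inverseˡ f)) (𝕊.+-identityʳ 𝟙))
  s²+𝕥²≐1 : s ⊛ s ⊕ 𝕥 ⊛ 𝕥 ≐ 𝟙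
  s²+𝕥²≐1 = 𝕊.trans (𝕊.+-congʳ {𝕥 ⊛ 𝕥} (pointwise (sqrt-square (𝟙 ⊕ (⊝ (𝕥 ⊛ 𝕥))) ≡.refl))) (cancel (𝕥 ⊛ 𝕥))

t[1+v²]≃2v : t * (1# + v ^ 2) ≃ 2# * v
t[1+v²]≃2v = *-cancelʳ t t≢0
  ([t[1+q²]]t≈[cq]t 2# t v (1# - √1-t²) (/-* (1# - √1-t²) t t≢0) t²+[1-√]²≃2[1-√])

corollary4p18 : (n : ℕ) → 1 ≤ n →
    (F n t ≈ ((1# + t) * (1# + t ^ 2) ^ n) / (2# * t) [ 2t≢0 ]
    * P^udr n ((2# * t) / (1# + t ^ 2) [ 1+t²≢0 ]))
    × (P^udr n t ≈ (2# * v) / ((1# + v) * (1# + v ^ 2) ^ n) [ [1+v][1+v²]ⁿ≢0 n ]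
    * F n v)
corollary4p18 (suc n) _ =
  ≃⇒≈ (≃-/ (F (suc n) t) (P^udr (suc n) z) ((1# + t) * (1# + t ^ 2) ^ suc n) (2# * t) 2t≢0
    (2x*F≃[1+x]yⁿ*P n t (1# + t ^ 2) z 𝕂.refl (/-* (2# * t) (1# + t ^ 2) 1+t²≢0))) ,
  -- With x = v the argument z is t itself. The equation is now solved for the sum over 𝔖, hence the
  -- symmetry.
  ≃⇒≈ (≃-/ (P^udr (suc n) t) (F (suc n) v) (2# * v) ((1# + v) * (1# + v ^ 2) ^ suc n) ([1+v][1+v²]ⁿ≢0 (suc n))
    (𝕂.sym (2x*F≃[1+x]yⁿ*P n v (1# + v ^ 2) t 𝕂.refl t[1+v²]≃2v)))
  where
  z : K
  z = (2# * t) / (1# + t ^ 2) [ 1+t²≢0 ]
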